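{- Let $G^u$ be a connected pointed graph. Its isomorphism type $\mathcal{Q}_{G^u}$ is expressed by a key-invariant LocalSum GNN whose combination functions are composed of semilinear functions and the squaring function $x\mapsto x^2$.
   Context: Fix a finite set $\Pi=\{p_1,\dots,p_n\}$ of propositions. A graph is $G=(V,E,\mathrm{lab})$ with $V$ finite, $E\subseteq V\times V$ irreflexive and symmetric, $\mathrm{lab}:V\to\{0,1\}^n$; a pointed graph $G^u$ has distinguished node $u$; isomorphisms of pointed graphs preserve labels, edges both ways and the distinguished node; a node query is an isomorphism-closed class of pointed graphs. The isomorphism type $\mathcal{Q}_{G^u}$ contains $H^v$ iff the connected component of $v$ in $H$, pointed at $v$, is isomorphic to $G^u$. A keyed extension adds an injective $\mathrm{key}:V\to\mathbb{R}$. A GNN is a sequence of layers $(\mathrm{agg}_i,\mathrm{com}_i)_{i=1}^\ell$, $\mathrm{com}_i:\mathbb{R}^{2D_i}\to\mathbb{R}^{D_{i+1}}$, $D_1=n+1$, $D_{\ell+1}=1$; on a keyed graph the initial embedding is $\mathrm{lab}(v)\oplus(\mathrm{key}(v))$, each layer computes $\mathrm{emb}'(u)=\mathrm{com}_i(\mathrm{emb}(u),\mathrm{agg}_i(\{\!\{\mathrm{emb}(v)\mid(u,v)\in E\}\!\}))$, output is the final value at the distinguished node. LocalSum: each $\mathrm{agg}_i$ is coordinate-wise sum. Accept iff output $>0$; key-invariant if for every pointed graph all or none of its keyed extensions are accepted; then it expresses the query of pointed graphs whose keyed extensions are accepted. A function $\mathbb{R}^k\to\mathbb{R}$ is semilinear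 if it is definable by a first-order formula without parameters over $(\mathbb{R},+,<,0,1)$ (equivalently, obtained by composition from affine functions with rational coefficients and $\mathrm{ifPos}(x,y,z)=y$ if $x>0$, $z$ otherwise). -}

module Defs where

open import Data.Nat as ℕ using (ℕ; zero; suc)
open import Data.Integer as ℤ using (ℤ; +_; -[1+_])
open import Data.Rational using (ℚ; ↥_; ↧ₙ_)
open import Data.Fin using (Fin; zero; suc)
open import Data.Vec using (Vec; []; _∷_; lookup; _++_; tabulate; _∷ʳ_)
import Data.Vec as Vec
open import Data.Bool using (Bool; true; false; if_then_else_)
open import Data.Product using (Σ; ∃; _×_; _,_)
open import Data.Sum using (_⊎_)
open import Relation.Nullary using (¬_)
open import Relation.Binary.PropositionalEquality using (_≡_; _≢_)
open import Relation.Binary.Definitions using (Trichotomous; tri<; tri≈; tri>)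
open import Function.Definitions using (Injective)
open import Function.Bundles using (_⇔_)

-- The real numbers, axiomatised as a (Dedekind-)complete ordered field
-- (unique up to isomorphism).  Agda's stdlib has no reals, so the
-- theorem is stated for every such structure.

record RealField : Set₁ where
  infixl 6 _+_
  infixl 7 _*_
  infix  4 _<_
  field
    ℝ       : Set
    0r 1r   : ℝ
    _+_ _*_ : ℝ → ℝ → ℝ
    -_      : ℝ → ℝ
    _⁻¹     : ℝ → ℝ
    _<_     : ℝ → ℝ → Set
    +-assoc    : ∀ x y z → (x + y) + z ≡ x + (y + z)
    +-comm     : ∀ x y → x + y ≡ y + x
    +-identity : ∀ x → 0r + x ≡ x
    +-inverse  : ∀ x → x + (- x) ≡ 0r
    *-assoc    : ∀ x y z → (x * y) * z ≡ x * (y * z)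
    *-comm     : ∀ x y → x * y ≡ y * x
    *-identity : ∀ x → 1r * x ≡ x
    *-inverse  : ∀ x → x ≢ 0r → x * (x ⁻¹) ≡ 1r
    distrib    : ∀ x y z → x * (y + z) ≡ x * y + x * z
    0≢1        : 0r ≢ 1r
    <-irrefl   : ∀ x → ¬ (x < x)
    <-trans    : ∀ {x y z} → x < y → y < z → x < z
    <-tri      : Trichotomous _≡_ _<_
    +-mono-<   : ∀ {x y} z → x < y → x + z < y + z
    *-pos      : ∀ {x y} → 0r < x → 0r < y → 0r < x * y
    complete   : (S : ℝ → Set) → Σ ℝ S →
                 Σ ℝ (λ b → ∀ x → S x → (x < b ⊎ x ≡ b)) →
                 Σ ℝ (λ s → (∀ x → S x → (x < s ⊎ x ≡ s)) ×
                            (∀ b → (∀ x → S x → (x < b ⊎ x ≡ b)) → (s < b ⊎ s ≡ b)))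

record Graph (n : ℕ) : Set where
  field
    size  : ℕ
    adj   : Fin size → Fin size → Bool
    irrefl : ∀ v → adj v v ≡ false
    sym   : ∀ v w → adj v w ≡ adj w v
    lab   : Fin size → Vec Bool n
open Graph public

data Reach {n} (H : Graph n) (v : Fin (size H)) : Fin (size H) → Set where
  here : Reach H v v
  step : ∀ {w x} → Reach H v w → adj H w x ≡ true → Reach H v x

Connected : ∀ {n} (G : Graph n) → Fin (size G) → Set
Connected G u = ∀ w → Reach G u w

record IsoToComponent {n} (G : Graph n) (u : Fin (size G))
                          (H : Graph n) (v : Fin (size H)) : Set where
  field
    φ        : Fin (size G) → Fin (size H)
    φ-inj    : Injective _≡_ _≡_ φ
    φ-into   : ∀ x → Reach H v (φ x)
    φ-onto   : ∀ w → Reach H v w → Σ (Fin (size G)) (λ x → φ x ≡ w)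
    φ-lab    : ∀ x → lab H (φ x) ≡ lab G x
    φ-adj    : ∀ x y → adj H (φ x) (φ y) ≡ adj G x y
    φ-point  : φ u ≡ v

InIsoType : ∀ {n} (G : Graph n) (u : Fin (size G)) (H : Graph n) (v : Fin (size H)) → Set
InIsoType G u H v = IsoToComponent G u H v

-- Functions built by composition from affine functions with rational
-- coefficients, ifPos (i.e. semilinear functions) and squaring x ↦ x².

data Term (k : ℕ) : Set where
  var   : Fin k → Term k
  const : ℚ → Term k
  add   : Term k → Term k → Term k
  scale : ℚ → Term k → Term k
  ifPos : Term k → Term k → Term k → Term k
  sq    : Term k → Term k

-- LocalSum GNN layers: combination functions com_i : ℝ^{2d} → ℝ^{d'},
-- given coordinatewise by terms; at least one layer, final dimension 1.
data Layers : ℕ → Set where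
  last  : ∀ {d} → Vec (Term (d ℕ.+ d)) 1 → Layers d
  layer : ∀ {d d'} → Vec (Term (d ℕ.+ d)) d' → Layers d' → Layers d

GNN : ℕ → Set
GNN n = Layers (suc n)

module Semantics (R : RealField) where
  open RealField R

  fromℕ : ℕ → ℝ
  fromℕ zero    = 0r
  fromℕ (suc m) = 1r + fromℕ m

  fromℤ : ℤ → ℝ
  fromℤ (+ m)      = fromℕ m
  fromℤ -[1+ m ]   = - (fromℕ (suc m))

  fromℚ : ℚ → ℝ
  fromℚ q = fromℤ (↥ q) * (fromℕ (↧ₙ q) ⁻¹)

  ifPosR : ℝ → ℝ → ℝ → ℝ
  ifPosR x y z with <-tri 0r x
  ... | tri< _ _ _ = y
  ... | tri≈ _ _ _ = z
  ... | tri> _ _ _ = z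

  eval : ∀ {k} → Term k → (Fin k → ℝ) → ℝ
  eval (var i)       ρ = ρ i
  eval (const q)     ρ = fromℚ q
  eval (add s t)     ρ = eval s ρ + eval t ρ
  eval (scale q t)   ρ = fromℚ q * eval t ρ
  eval (ifPos s t r) ρ = ifPosR (eval s ρ) (eval t ρ) (eval r ρ)
  eval (sq t)        ρ = eval t ρ * eval t ρ

  sumFin : ∀ {k} → (Fin k → ℝ) → ℝ
  sumFin {zero}  f = 0r
  sumFin {suc k} f = f zero + sumFin (λ i → f (suc i))

  bit : Bool → ℝ
  bit true  = 1r
  bit false = 0r

  module _ {n} (H : Graph n) where
    aggSum : ∀ {d} → (Fin (size H) → Vec ℝ d) → Fin (size H) → Vec ℝ d
    aggSum emb u = tabulate λ i →
      sumFin (λ w → if adj H u w then lookup (emb w) i else 0r)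

    applyCom : ∀ {d d'} → Vec (Term (d ℕ.+ d)) d' →
               (Fin (size H) → Vec ℝ d) → Fin (size H) → Vec ℝ d'
    applyCom com emb u =
      Vec.map (λ t → eval t (lookup (emb u ++ aggSum emb u))) com

    run : ∀ {d} → Layers d → (Fin (size H) → Vec ℝ d) → Fin (size H) → ℝ
    run (last com)      emb u = lookup (applyCom com emb u) zero
    run (layer com ls)  emb u = run ls (applyCom com emb) u

    initEmb : (Fin (size H) → ℝ) → Fin (size H) → Vec ℝ (suc n)
    initEmb key v = Vec.map bit (lab H v) ∷ʳ key v

    Accepts : GNN n → (Fin (size H) → ℝ) → Fin (size H) → Set
    Accepts N key v = 0r < run N (initEmb key) v

  KeyInvariant : ∀ {n} → GNN n → Set
  KeyInvariant {n} N = ∀ (H : Graph n) (v : Fin (size H))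
    (key₁ key₂ : Fin (size H) → ℝ) →
    Injective _≡_ _≡_ key₁ → Injective _≡_ _≡_ key₂ →
    Accepts H N key₁ v → Accepts H N key₂ v

  Expresses : ∀ {n} → GNN n → ((H : Graph n) → Fin (size H) → Set) → Set
  Expresses {n} N Q = KeyInvariant N ×
    (∀ (H : Graph n) (v : Fin (size H)) →
      Q H v ⇔ (∀ (key : Fin (size H) → ℝ) → Injective _≡_ _≡_ key → Accepts H N key v))

{-# OPTIONS --safe #-}

-- A lazy walk may stay put or follow an edge.  If F is a polynomial in the keys and label
-- indicators of the nodes of a walk, then the sum of F over all lazy walks of length T
-- from v is computed by a LocalSum GNN: expand F into products of one-node factors,
-- sum each product by T rounds of message passing, and multiply by polarisation.
-- Since keys are injective, (key x - key y)² is positive exactly when x ≠ y, so positivity of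
-- such sums decides whether some lazy walk from v satisfies given disequalities and labels.
--
-- Fix a tour x₀ … x_L of G from u that traverses every edge, and for each node a of G a
-- time pos a at which it is visited.  A lazy walk z in H is a placement of G if
-- z_i ≠ z_(pos a) whenever x_i ≠ a.  Accept iff some placement carries the right labels
-- (good), and no placement goes on to be, at time 2L, at none of the z_(pos a) with
-- a ≠ x and, at time 2L + 1, at neither z_(pos x) nor a z_(pos a) with a adjacent to x (bad).
-- If so, a ↦ z_(pos a) has an image closed under adjacency and is an isomorphism onto the
-- component.  Conversely, in a copy of G every placement is an injective endomorphism of a
-- finite graph, hence an automorphism, and automorphisms do not admit bad continuations.

module Submission where

open import Defs hiding (sym)
open import Algebra.Bundles using (CommutativeRing)
import Algebra.Properties.CommutativeSemigroup as CommutativeSemigroupProperties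
import Algebra.Properties.Ring as RingProperties
import Algebra.Solver.Ring.NaturalCoefficients.Default as SemiringSolver
open import Data.Bool using (Bool; true; false; if_then_else_)
import Data.Bool.Properties as Bool
open import Data.Empty using (⊥-elim)
open import Data.Fin using (Fin; zero; suc; toℕ; fromℕ<; inject₁; _↑ˡ_; _↑ʳ_)
import Data.Fin as Fin
import Data.Fin.Properties as Fin
open import Data.List using (List; []; _∷_; _++_; map; length; cartesianProductWith)
open import Data.Nat using (ℕ; zero; suc; _≤_; z≤n; s≤s)
import Data.Nat as ℕ
import Data.Nat.Properties as ℕ
open import Data.Product using (Σ; ∃; _×_; _,_; proj₁; proj₂)
import Data.Rational as ℚ
open import Data.Sum using (_⊎_; inj₁; inj₂)
open import Data.Vec using (Vec; []; _∷_; _∷ʳ_; lookup; tabulate)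
import Data.Vec as Vec
import Data.Vec.Properties as Vec
open import Function using (_∘_; case_of_)
open import Function.Bundles using (mk⇔)
open import Function.Definitions using (Injective)
open import Relation.Binary.Definitions using (tri<; tri≈; tri>)
open import Relation.Binary.PropositionalEquality using (_≡_; _≢_; refl; sym; trans; cong; cong₂; subst; subst₂; isEquivalence; module ≡-Reasoning)
open import Relation.Nullary using (¬_; Dec; yes; no)
open import Relation.Nullary.Decidable using (¬?; _×-dec_)

-- Lazy walks and formulas about their nodes

module LazyWalk {n : ℕ} (H : Graph n) where

  infix 4 _∼_

  _∼_ : Fin (size H) → Fin (size H) → Set
  v ∼ w = v ≡ w ⊎ adj H v w ≡ true

  IsWalk : (ℕ → Fin (size H)) → Set
  IsWalk z = ∀ i → z i ∼ z (suc i)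

cons : {A : Set} → A → (ℕ → A) → ℕ → A
cons a z zero    = a
cons a z (suc i) = z i

-- Each constructor matches an operation on nonnegative reals for which positivity means truth, so
-- there is neither negation nor equality of nodes. The guard of `⇒` is decided while the network is
-- built. The bounds ensure that a formula looks only at times up to `T`.
data Form (n T : ℕ) : Set₁ where
  neq      : ∀ s t → s ≤ T → t ≤ T → Form n T
  labelled : ∀ s → s ≤ T → Vec Bool n → Form n T
  _∧_      : Form n T → Form n T → Form n T
  _⇒_      : {P : Set} → Dec P → Form n T → Form n T
  ⋀ ⋁      : ∀ {k} → (Fin k → Form n T) → Form n T

infixr 5 _∧_
infixr 6 _⇒_

module _ {n : ℕ} (H : Graph n) where
  open LazyWalk H

  infix 4 _⊨_

  _⊨_ : ∀ {T} → (ℕ → Fin (size H)) → Form n T → Set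
  z ⊨ neq s t _ _      = z s ≢ z t
  z ⊨ labelled s _ l   = lab H (z s) ≡ l
  z ⊨ F ∧ F′           = z ⊨ F × z ⊨ F′
  z ⊨ (_⇒_ {P} _ F)    = P → z ⊨ F
  z ⊨ ⋀ F              = ∀ i → z ⊨ F i
  z ⊨ ⋁ F              = ∃ λ i → z ⊨ F i

  Sat : ∀ {T} → Fin (size H) → Form n T → Set
  Sat v F = ∃ λ z → z 0 ≡ v × IsWalk z × z ⊨ F

  ⊨-resp : ∀ {T} {z z′ : ℕ → Fin (size H)} → (∀ i → i ≤ T → z i ≡ z′ i) →
           (F : Form n T) → z ⊨ F → z′ ⊨ F
  ⊨-resp e (neq s t p q)    h h′      = h (trans (e s p) (trans h′ (sym (e t q))))
  ⊨-resp e (labelled s p l) h         = trans (cong (lab H) (sym (e s p))) h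
  ⊨-resp e (F ∧ F′)         (h , h′)  = ⊨-resp e F h , ⊨-resp e F′ h′
  ⊨-resp e (_ ⇒ F)          h p       = ⊨-resp e F (h p)
  ⊨-resp e (⋀ F)            h i       = ⊨-resp e (F i) (h i)
  ⊨-resp e (⋁ F)            (i , h)   = i , ⊨-resp e (F i) h

-- Ordered-field arithmetic, finite sums and products

module OrderedField (R : RealField) where
  open RealField R
  open Semantics R

  commutativeRing : CommutativeRing _ _
  commutativeRing = record
    { Carrier = ℝ ; _≈_ = _≡_ ; _+_ = _+_ ; _*_ = _*_ ; -_ = -_ ; 0# = 0r ; 1# = 1r
    ; isCommutativeRing = record
      { isRing = record
        { +-isAbelianGroup = record
          { isGroup = record
            { isMonoid = record
              { isSemigroup = record
                { isMagma = record { isEquivalence = isEquivalence ; ∙-cong = cong₂ _+_ }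
                ; assoc = +-assoc }
              ; identity = +-identity , λ x → trans (+-comm x 0r) (+-identity x) }
            ; inverse = (λ x → trans (+-comm (- x) x) (+-inverse x)) , +-inverse
            ; ⁻¹-cong = cong -_ }
          ; comm = +-comm }
        ; *-cong = cong₂ _*_
        ; *-assoc = *-assoc
        ; *-identity = *-identity , λ x → trans (*-comm x 1r) (*-identity x)
        ; distrib = distrib , λ x y z → trans (*-comm (y + z) x)
                      (trans (distrib x y z) (cong₂ _+_ (*-comm x y) (*-comm x z))) }
      ; *-comm = *-comm } }

  open CommutativeRing commutativeRing public
    using (ring; commutativeSemiring; +-identityʳ; *-identityʳ; zeroˡ; zeroʳ; -‿inverseˡ;
           distribʳ; +-commutativeSemigroup; *-commutativeSemigroup)
  open RingProperties ring public
    using (-‿distribʳ-*; -‿distribˡ-*; -‿involutive; -‿+-comm; -1*x≈-x; x∙y⁻¹≈ε⇒x≈y)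
  open CommutativeSemigroupProperties +-commutativeSemigroup public
    using () renaming (interchange to +-interchange)
  open CommutativeSemigroupProperties *-commutativeSemigroup public
    using () renaming (interchange to *-interchange)

  Nonneg : ℝ → Set
  Nonneg x = 0r < x ⊎ 0r ≡ x

  neg-pos : ∀ {x} → x < 0r → 0r < - x
  neg-pos {x} x<0 = subst₂ _<_ (+-inverse x) (+-identity (- x)) (+-mono-< (- x) x<0)

  square-pos : ∀ {x} → x ≢ 0r → 0r < x * x
  square-pos {x} x≢0 with <-tri 0r x
  ... | tri< 0<x _ _ = *-pos 0<x 0<x
  ... | tri≈ _ 0≡x _ = ⊥-elim (x≢0 (sym 0≡x))
  ... | tri> _ _ x<0 = subst (0r <_) -x*-x≡x*x (*-pos (neg-pos x<0) (neg-pos x<0))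
    where
    -x*-x≡x*x : - x * - x ≡ x * x
    -x*-x≡x*x = trans (sym (-‿distribˡ-* x (- x)))
                 (trans (cong -_ (sym (-‿distribʳ-* x x))) (-‿involutive (x * x)))

  square-nonneg : ∀ x → Nonneg (x * x)
  square-nonneg x with <-tri x 0r
  ... | tri≈ _ refl _ = inj₂ (sym (zeroˡ 0r))
  ... | tri< _ x≢0 _  = inj₁ (square-pos x≢0)
  ... | tri> _ x≢0 _  = inj₁ (square-pos x≢0)

  0<1 : 0r < 1r
  0<1 = subst (0r <_) (*-identity 1r) (square-pos (0≢1 ∘ sym))

  pos-+-nonneg : ∀ {x y} → 0r < x → Nonneg y → 0r < x + y
  pos-+-nonneg {x} {y} 0<x (inj₁ 0<y)  =
    <-trans 0<y (subst (_< x + y) (+-identity y) (+-mono-< y 0<x))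
  pos-+-nonneg {x} 0<x (inj₂ refl) = subst (0r <_) (sym (+-identityʳ x)) 0<x

  nonneg-+-pos : ∀ {x y} → Nonneg x → 0r < y → 0r < x + y
  nonneg-+-pos {x} {y} x≥0 0<y = subst (0r <_) (+-comm y x) (pos-+-nonneg 0<y x≥0)

  +-nonneg : ∀ {x y} → Nonneg x → Nonneg y → Nonneg (x + y)
  +-nonneg (inj₁ 0<x)  y≥0 = inj₁ (pos-+-nonneg 0<x y≥0)
  +-nonneg {y = y} (inj₂ refl) y≥0 = subst Nonneg (sym (+-identity y)) y≥0

  +-pos⁻ : ∀ {x y} → Nonneg x → 0r < x + y → 0r < x ⊎ 0r < y
  +-pos⁻ (inj₁ 0<x)  _ = inj₁ 0<x
  +-pos⁻ {y = y} (inj₂ refl) h = inj₂ (subst (0r <_) (+-identity y) h)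

  *-nonneg : ∀ {x y} → Nonneg x → Nonneg y → Nonneg (x * y)
  *-nonneg (inj₁ 0<x) (inj₁ 0<y)  = inj₁ (*-pos 0<x 0<y)
  *-nonneg {x} _ (inj₂ refl)      = inj₂ (sym (zeroʳ x))
  *-nonneg {y = y} (inj₂ refl) _  = inj₂ (sym (zeroˡ y))

  *-pos⁻ : ∀ {x y} → Nonneg x → Nonneg y → 0r < x * y → 0r < x × 0r < y
  *-pos⁻ (inj₁ 0<x) (inj₁ 0<y) _ = 0<x , 0<y
  *-pos⁻ {x} _ (inj₂ refl) h     = ⊥-elim (<-irrefl 0r (subst (0r <_) (zeroʳ x) h))
  *-pos⁻ {y = y} (inj₂ refl) _ h = ⊥-elim (<-irrefl 0r (subst (0r <_) (zeroˡ y) h))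

  sumFin-cong : ∀ {k} {f g : Fin k → ℝ} → (∀ i → f i ≡ g i) → sumFin f ≡ sumFin g
  sumFin-cong {zero}  e = refl
  sumFin-cong {suc k} e = cong₂ _+_ (e zero) (sumFin-cong (e ∘ suc))

  sumFin-+ : ∀ {k} (f g : Fin k → ℝ) → sumFin (λ i → f i + g i) ≡ sumFin f + sumFin g
  sumFin-+ {zero}  f g = sym (+-identity 0r)
  sumFin-+ {suc k} f g =
    trans (cong ((f zero + g zero) +_) (sumFin-+ (f ∘ suc) (g ∘ suc)))
          (+-interchange (f zero) (g zero) (sumFin (f ∘ suc)) (sumFin (g ∘ suc)))

  sumFin-* : ∀ {k} a (f : Fin k → ℝ) → sumFin (λ i → a * f i) ≡ a * sumFin f
  sumFin-* {zero}  a f = sym (zeroʳ a)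
  sumFin-* {suc k} a f =
    trans (cong (a * f zero +_) (sumFin-* a (f ∘ suc))) (sym (distrib a (f zero) _))

  sumFin-nonneg : ∀ {k} {f : Fin k → ℝ} → (∀ i → Nonneg (f i)) → Nonneg (sumFin f)
  sumFin-nonneg {zero}  f≥0 = inj₂ refl
  sumFin-nonneg {suc k} f≥0 = +-nonneg (f≥0 zero) (sumFin-nonneg (f≥0 ∘ suc))

  sumFin-pos : ∀ {k} {f : Fin k → ℝ} → (∀ i → Nonneg (f i)) → ∀ i → 0r < f i → 0r < sumFin f
  sumFin-pos f≥0 zero    h = pos-+-nonneg h (sumFin-nonneg (f≥0 ∘ suc))
  sumFin-pos f≥0 (suc i) h = nonneg-+-pos (f≥0 zero) (sumFin-pos (f≥0 ∘ suc) i h)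

  sumFin-pos⁻ : ∀ {k} {f : Fin k → ℝ} → (∀ i → Nonneg (f i)) → 0r < sumFin f → ∃ λ i → 0r < f i
  sumFin-pos⁻ {zero}  f≥0 h = ⊥-elim (<-irrefl 0r h)
  sumFin-pos⁻ {suc k} f≥0 h with +-pos⁻ (f≥0 zero) h
  ... | inj₁ h₀ = zero , h₀
  ... | inj₂ hs with i , hᵢ ← sumFin-pos⁻ (f≥0 ∘ suc) hs = suc i , hᵢ

  prodFin : ∀ {k} → (Fin k → ℝ) → ℝ
  prodFin {zero}  f = 1r
  prodFin {suc k} f = f zero * prodFin (f ∘ suc)

  prodFin-cong : ∀ {k} {f g : Fin k → ℝ} → (∀ i → f i ≡ g i) → prodFin f ≡ prodFin g
  prodFin-cong {zero}  e = refl
  prodFin-cong {suc k} e = cong₂ _*_ (e zero) (prodFin-cong (e ∘ suc))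

  prodFin-nonneg : ∀ {k} {f : Fin k → ℝ} → (∀ i → Nonneg (f i)) → Nonneg (prodFin f)
  prodFin-nonneg {zero}  f≥0 = inj₁ 0<1
  prodFin-nonneg {suc k} f≥0 = *-nonneg (f≥0 zero) (prodFin-nonneg (f≥0 ∘ suc))

  prodFin-pos : ∀ {k} {f : Fin k → ℝ} → (∀ i → 0r < f i) → 0r < prodFin f
  prodFin-pos {zero}  f>0 = 0<1
  prodFin-pos {suc k} f>0 = *-pos (f>0 zero) (prodFin-pos (f>0 ∘ suc))

  prodFin-pos⁻ : ∀ {k} {f : Fin k → ℝ} → (∀ i → Nonneg (f i)) → 0r < prodFin f → ∀ i → 0r < f i
  prodFin-pos⁻ f≥0 h zero    = proj₁ (*-pos⁻ (f≥0 zero) (prodFin-nonneg (f≥0 ∘ suc)) h)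
  prodFin-pos⁻ f≥0 h (suc i) =
    prodFin-pos⁻ (f≥0 ∘ suc) (proj₂ (*-pos⁻ (f≥0 zero) (prodFin-nonneg (f≥0 ∘ suc)) h)) i

  sumOver : {A : Set} → List A → (A → ℝ) → ℝ
  sumOver []       f = 0r
  sumOver (a ∷ as) f = f a + sumOver as f

  sumOver-cong : {A : Set} {f g : A → ℝ} → (∀ a → f a ≡ g a) → ∀ as → sumOver as f ≡ sumOver as g
  sumOver-cong e []       = refl
  sumOver-cong e (a ∷ as) = cong₂ _+_ (e a) (sumOver-cong e as)

  sumOver-++ : {A : Set} (as bs : List A) (f : A → ℝ) →
               sumOver (as ++ bs) f ≡ sumOver as f + sumOver bs f
  sumOver-++ []       bs f = sym (+-identity _)
  sumOver-++ (a ∷ as) bs f = trans (cong (f a +_) (sumOver-++ as bs f)) (sym (+-assoc _ _ _))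

  sumOver-map : {A B : Set} (g : A → B) (as : List A) (f : B → ℝ) →
                sumOver (map g as) f ≡ sumOver as (f ∘ g)
  sumOver-map g []       f = refl
  sumOver-map g (a ∷ as) f = cong (f (g a) +_) (sumOver-map g as f)

  sumOver-* : {A : Set} (c : ℝ) (as : List A) (f : A → ℝ) →
              sumOver as (λ a → c * f a) ≡ c * sumOver as f
  sumOver-* c []       f = sym (zeroʳ c)
  sumOver-* c (a ∷ as) f = trans (cong (c * f a +_) (sumOver-* c as f)) (sym (distrib c _ _))

  sumOver-lookup : {A : Set} (as : List A) (f : A → ℝ) →
                   sumFin (λ i → f (lookup (Vec.fromList as) i)) ≡ sumOver as f
  sumOver-lookup []       f = refl
  sumOver-lookup (a ∷ as) f = cong (f a +_) (sumOver-lookup as f)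

  -- Distributivity, one summand per pair. With `h` the product of columns, it shows that `⊗`
  -- multiplies weights.
  sumOver-cartesianProductWith :
    {A : Set} {h : A → A → A} {f : A → ℝ} → (∀ a b → f (h a b) ≡ f a * f b) →
    ∀ as bs → sumOver (cartesianProductWith h as bs) f ≡ sumOver as f * sumOver bs f
  sumOver-cartesianProductWith e [] bs = sym (zeroˡ _)
  sumOver-cartesianProductWith {h = h} {f} e (a ∷ as) bs = begin
    sumOver (map (h a) bs ++ cartesianProductWith h as bs) f
      ≡⟨ sumOver-++ (map (h a) bs) _ f ⟩
    sumOver (map (h a) bs) f + sumOver (cartesianProductWith h as bs) f
      ≡⟨ cong₂ _+_ (trans (sumOver-map (h a) bs f) (trans (sumOver-cong (e a) bs) (sumOver-* (f a) bs f)))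
                   (sumOver-cartesianProductWith e as bs) ⟩
    f a * sumOver bs f + sumOver as f * sumOver bs f
      ≡⟨ distribʳ _ _ _ ⟨
    (f a + sumOver as f) * sumOver bs f ∎
    where open ≡-Reasoning

  fromℕ-pos : ∀ m → 0r < fromℕ (suc m)
  fromℕ-pos zero    = pos-+-nonneg 0<1 (inj₂ refl)
  fromℕ-pos (suc m) = pos-+-nonneg 0<1 (inj₁ (fromℕ-pos m))

  fromℕ-injective : ∀ {m m′} → fromℕ m ≡ fromℕ m′ → m ≡ m′
  fromℕ-injective {zero}  {zero}   _ = refl
  fromℕ-injective {zero}  {suc m′} e = ⊥-elim (<-irrefl 0r (subst (0r <_) (sym e) (fromℕ-pos m′)))
  fromℕ-injective {suc m} {zero}   e = ⊥-elim (<-irrefl 0r (subst (0r <_) e (fromℕ-pos m)))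
  fromℕ-injective {suc m} {suc m′} e = cong suc (fromℕ-injective (+-cancelˡ e))
    where
    +-cancelˡ : ∀ {x y} → 1r + x ≡ 1r + y → x ≡ y
    +-cancelˡ {x} {y} h = begin
      x                  ≡⟨ shift x ⟨
      - 1r + (1r + x)    ≡⟨ cong (- 1r +_) h ⟩
      - 1r + (1r + y)    ≡⟨ shift y ⟩
      y                  ∎
      where
      open ≡-Reasoning
      shift : ∀ a → - 1r + (1r + a) ≡ a
      shift a = trans (sym (+-assoc _ _ _)) (trans (cong (_+ a) (-‿inverseˡ 1r)) (+-identity a))

  fromℚ-0 : fromℚ ℚ.0ℚ ≡ 0r
  fromℚ-0 = zeroˡ _

  fromℚ-1 : fromℚ ℚ.1ℚ ≡ 1r
  fromℚ-1 = *-inverse (1r + 0r) (λ e → 0≢1 (trans (sym e) (+-identityʳ 1r)))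

  fromℚ--1* : ∀ x → fromℚ (ℚ.- ℚ.1ℚ) * x ≡ - x
  fromℚ--1* x = trans (cong (_* x) (trans (sym (-‿distribˡ-* _ _)) (cong -_ fromℚ-1))) (-1*x≈-x x)

  fromℚ-½* : ∀ x → fromℚ ℚ.½ * (x + x) ≡ x
  fromℚ-½* x = begin
    -- `fromℚ ℚ.½` unfolds to the numerator `1r + 0r` times the inverse of the denominator
    -- `1r + (1r + 0r)`.
    ((1r + 0r) * d) * (x + x)        ≡⟨ cong (λ y → (y * d) * (x + x)) (+-identityʳ 1r) ⟩
    (1r * d) * (x + x)               ≡⟨ cong (_* (x + x)) (*-identity d) ⟩
    d * (x + x)                      ≡⟨ cong (d *_) (solve 1 (λ y → y :+ y := (con 1 :+ (con 1 :+ con 0)) :* y) refl x) ⟩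
    d * ((1r + (1r + 0r)) * x)       ≡⟨ *-assoc _ _ _ ⟨
    (d * (1r + (1r + 0r))) * x       ≡⟨ cong (_* x) (trans (*-comm _ _) (*-inverse _ λ e → <-irrefl 0r (subst (0r <_) e (fromℕ-pos 1)))) ⟩
    1r * x                           ≡⟨ *-identity x ⟩
    x                                ∎
    where
    open ≡-Reasoning
    open SemiringSolver commutativeSemiring
    d = (1r + (1r + 0r)) ⁻¹

  -- The left side has the shape that evaluating `mul` produces, with the two squares negated
  -- separately; `fromℚ-½*` then halves the right side.
  polarisation : ∀ x y → (x + y) * (x + y) + (- (x * x) + - (y * y)) ≡ x * y + x * y
  polarisation x y = begin
    (x + y) * (x + y) + (- (x * x) + - (y * y))
      ≡⟨ cong₂ _+_ (solve 2 (λ a b → (a :+ b) :* (a :+ b) := (a :* b :+ a :* b) :+ (a :* a :+ b :* b)) refl x y)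
                   (-‿+-comm (x * x) (y * y)) ⟩
    (x * y + x * y) + (x * x + y * y) + - (x * x + y * y)   ≡⟨ +-assoc _ _ _ ⟩
    (x * y + x * y) + ((x * x + y * y) + - (x * x + y * y)) ≡⟨ cong (_ +_) (+-inverse _) ⟩
    (x * y + x * y) + 0r                                    ≡⟨ +-identityʳ _ ⟩
    x * y + x * y ∎
    where
    open ≡-Reasoning
    open SemiringSolver commutativeSemiring

-- Construction of the network

rename : ∀ {k k′} → (Fin k → Fin k′) → Term k → Term k′
rename r (var i)       = var (r i)
rename r (const q)     = const q
rename r (add s t)     = add (rename r s) (rename r t)
rename r (scale q t)   = scale q (rename r t)
rename r (ifPos s t u) = ifPos (rename r s) (rename r t) (rename r u)
rename r (sq t)        = sq (rename r t)

mul : ∀ {k} → Term k → Term k → Term k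
mul s t = scale ℚ.½ (add (sq (add s t)) (add (scale (ℚ.- ℚ.1ℚ) (sq s)) (scale (ℚ.- ℚ.1ℚ) (sq t))))

sumTerm : ∀ {k m} → (Fin m → Term k) → Term k
sumTerm {m = zero}  f = const ℚ.0ℚ
sumTerm {m = suc m} f = add (f zero) (sumTerm (f ∘ suc))

indicator : ∀ {k m} → Vec Bool m → (Fin m → Term k) → Term k
indicator []          x = const ℚ.1ℚ
indicator (true  ∷ l) x = ifPos (x zero) (indicator l (x ∘ suc)) (const ℚ.0ℚ)
indicator (false ∷ l) x = ifPos (x zero) (const ℚ.0ℚ) (indicator l (x ∘ suc))

-- A column is a rank-one weight on walks: the product over i ≤ T of the i-th term
-- evaluated at the i-th node.  A list of columns stands for the sum of these weights.
Column : ℕ → Set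
Column b = ℕ → Term b

one : ∀ {b} → Column b
one _ = const ℚ.1ℚ

at : ∀ {b} → ℕ → Term b → Column b
at s t = single s
  where
  single : ℕ → Column _
  single zero    = cons t one
  single (suc s) = cons (const ℚ.1ℚ) (single s)

_⊗_ : ∀ {b} → List (Column b) → List (Column b) → List (Column b)
_⊗_ = cartesianProductWith (λ c d i → mul (c i) (d i))

⨂ : ∀ {b k} → (Fin k → List (Column b)) → List (Column b)
⨂ {k = zero}  S = one ∷ []
⨂ {k = suc k} S = S zero ⊗ ⨂ (S ∘ suc)

⨁ : ∀ {b k} → (Fin k → List (Column b)) → List (Column b)
⨁ {k = zero}  S = []
⨁ {k = suc k} S = S zero ++ ⨁ (S ∘ suc)

keyTerm : ∀ {n} → Term (suc n)
keyTerm {n} = var (Fin.fromℕ n)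

-- A difference of two keys depends on two nodes and is no product of one-node factors, hence a sum
-- of two columns. Its square by `⊗` has four.
difference : ∀ {n} → ℕ → ℕ → List (Column (suc n))
difference s t = at s keyTerm ∷ at t (scale (ℚ.- ℚ.1ℚ) keyTerm) ∷ []

columns : ∀ {n T} → Form n T → List (Column (suc n))
columns (neq s t _ _)    = difference s t ⊗ difference s t
columns (labelled s _ l) = at s (indicator l (var ∘ inject₁)) ∷ []
columns (F ∧ F′)         = columns F ⊗ columns F′
columns (yes _ ⇒ F)      = columns F
-- A false guard makes the implication true, hence the constant weight 1.
columns (no _ ⇒ F)       = one ∷ []
columns (⋀ F)            = ⨂ (columns ∘ F)
columns (⋁ F)            = ⨁ (columns ∘ F)

-- The first `b` coordinates carry the input embedding along, because each later layer evaluates a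
-- new term on it.
initCom : ∀ {b M} → (Fin M → Column b) → Vec (Term (b ℕ.+ b)) (b ℕ.+ M)
initCom {b} cs = tabulate (λ i → var (i ↑ˡ b)) Vec.++ tabulate (λ j → rename (_↑ˡ b) (cs j 0))

stepCom : ∀ {b M} → (Fin M → Column b) → Vec (Term ((b ℕ.+ M) ℕ.+ (b ℕ.+ M))) (b ℕ.+ M)
stepCom {b} {M} cs =
  tabulate (λ i → var ((i ↑ˡ M) ↑ˡ (b ℕ.+ M)))
    Vec.++
  tabulate (λ j → mul (rename (λ i → (i ↑ˡ M) ↑ˡ (b ℕ.+ M)) (cs j 0)) (closedNbhdTerm j))
  where
  closedNbhdTerm : Fin M → Term ((b ℕ.+ M) ℕ.+ (b ℕ.+ M))
  -- The own value accounts for staying put and the aggregated value for following an edge.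
  closedNbhdTerm j = add (var ((b ↑ʳ j) ↑ˡ (b ℕ.+ M))) (var ((b ℕ.+ M) ↑ʳ (b ↑ʳ j)))

-- Walks are summed from their far end: the first layer weighs the last node and every later layer
-- prepends an earlier one. So the recursion removes the heads of the columns and places their layer
-- after all the others.
walkLayers : ∀ {b M} → ℕ → (Fin M → Column b) → Layers (b ℕ.+ M) → Layers b
walkLayers zero    cs rest = layer (initCom cs) rest
walkLayers (suc T) cs rest = walkLayers T (λ j → cs j ∘ suc) (layer (stepCom cs) rest)

module _ {b : ℕ} (S S′ : List (Column b)) where

  joined : Fin (length S ℕ.+ length S′) → Column b
  joined = lookup (Vec.fromList S Vec.++ Vec.fromList S′)

  private
    D : ℕ
    D = b ℕ.+ (length S ℕ.+ length S′)

  left : Term (D ℕ.+ D)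
  left = sumTerm (λ (j : Fin (length S)) → var ((b ↑ʳ (j ↑ˡ length S′)) ↑ˡ D))

  right : Term (D ℕ.+ D)
  right = sumTerm (λ (j : Fin (length S′)) → var ((b ↑ʳ (length S ↑ʳ j)) ↑ˡ D))

  -- Both lists share one embedding because the final test reads both sums. The default output 0
  -- rejects, since acceptance is strict positivity.
  guardedLayers : ℕ → Layers b
  guardedLayers T = walkLayers T joined (last (ifPos right (const ℚ.0ℚ) left ∷ []))

machine : ∀ {n T} → Form n T → Form n T → GNN n
machine {T = T} F F′ = guardedLayers (columns F) (columns F′) T

-- Evaluation of terms

module TermEval (R : RealField) where
  open RealField R
  open Semantics R
  open OrderedField R

  ifPosR-pos : ∀ {x y z} → 0r < x → ifPosR x y z ≡ y
  ifPosR-pos {x} 0<x with <-tri 0r x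
  ... | tri< _ _ _   = refl
  ... | tri≈ 0≮x _ _ = ⊥-elim (0≮x 0<x)
  ... | tri> 0≮x _ _ = ⊥-elim (0≮x 0<x)

  ifPosR-¬pos : ∀ {x y z} → ¬ 0r < x → ifPosR x y z ≡ z
  ifPosR-¬pos {x} 0≮x with <-tri 0r x
  ... | tri< 0<x _ _ = ⊥-elim (0≮x 0<x)
  ... | tri≈ _ _ _   = refl
  ... | tri> _ _ _   = refl

  eval-rename : ∀ {k k′} (r : Fin k → Fin k′) {ρ σ} → (∀ i → ρ (r i) ≡ σ i) →
                ∀ t → eval (rename r t) ρ ≡ eval t σ
  eval-rename r e (var i)       = e i
  eval-rename r e (const q)     = refl
  eval-rename r e (add s t)     = cong₂ _+_ (eval-rename r e s) (eval-rename r e t)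
  eval-rename r e (scale q t)   = cong (fromℚ q *_) (eval-rename r e t)
  eval-rename r e (ifPos s t u) =
    trans (cong₂ (λ x y → ifPosR x y _) (eval-rename r e s) (eval-rename r e t))
          (cong (ifPosR _ _) (eval-rename r e u))
  eval-rename r e (sq t)        = cong₂ _*_ (eval-rename r e t) (eval-rename r e t)

  eval-mul : ∀ {k} (s t : Term k) ρ → eval (mul s t) ρ ≡ eval s ρ * eval t ρ
  eval-mul s t ρ =
    trans (cong (fromℚ ℚ.½ *_)
            (trans (cong ((x + y) * (x + y) +_) (cong₂ _+_ (fromℚ--1* (x * x)) (fromℚ--1* (y * y))))
                   (polarisation x y)))
          (fromℚ-½* (x * y))
    where
    x = eval s ρ
    y = eval t ρ

  eval-sumTerm : ∀ {k m} (f : Fin m → Term k) ρ → eval (sumTerm f) ρ ≡ sumFin (λ i → eval (f i) ρ)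
  eval-sumTerm {m = zero}  f ρ = fromℚ-0
  eval-sumTerm {m = suc m} f ρ = cong (eval (f zero) ρ +_) (eval-sumTerm (f ∘ suc) ρ)

  module _ {k : ℕ} (ρ : Fin k → ℝ) where

    eval-indicator-≡ : ∀ {m} (l l′ : Vec Bool m) x → (∀ i → eval (x i) ρ ≡ bit (lookup l′ i)) →
                       l′ ≡ l → eval (indicator l x) ρ ≡ 1r
    eval-indicator-≡ [] [] x e refl = fromℚ-1
    eval-indicator-≡ (true ∷ l) (.true ∷ .l) x e refl =
      trans (ifPosR-pos (subst (0r <_) (sym (e zero)) 0<1)) (eval-indicator-≡ l l (x ∘ suc) (e ∘ suc) refl)
    eval-indicator-≡ (false ∷ l) (.false ∷ .l) x e refl =
      trans (ifPosR-¬pos (λ h → <-irrefl 0r (subst (0r <_) (e zero) h)))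
            (eval-indicator-≡ l l (x ∘ suc) (e ∘ suc) refl)

    eval-indicator-≢ : ∀ {m} (l l′ : Vec Bool m) x → (∀ i → eval (x i) ρ ≡ bit (lookup l′ i)) →
                       l′ ≢ l → eval (indicator l x) ρ ≡ 0r
    eval-indicator-≢ [] [] x e l′≢l = ⊥-elim (l′≢l refl)
    eval-indicator-≢ (true ∷ l) (true ∷ l′) x e l′≢l =
      trans (ifPosR-pos (subst (0r <_) (sym (e zero)) 0<1))
            (eval-indicator-≢ l l′ (x ∘ suc) (e ∘ suc) (l′≢l ∘ cong (true ∷_)))
    eval-indicator-≢ (true ∷ l) (false ∷ l′) x e l′≢l =
      trans (ifPosR-¬pos (λ h → <-irrefl 0r (subst (0r <_) (e zero) h))) fromℚ-0
    eval-indicator-≢ (false ∷ l) (true ∷ l′) x e l′≢l =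
      trans (ifPosR-pos (subst (0r <_) (sym (e zero)) 0<1)) fromℚ-0
    eval-indicator-≢ (false ∷ l) (false ∷ l′) x e l′≢l =
      trans (ifPosR-¬pos (λ h → <-irrefl 0r (subst (0r <_) (e zero) h)))
            (eval-indicator-≢ l l′ (x ∘ suc) (e ∘ suc) (l′≢l ∘ cong (false ∷_)))

-- Sums over lazy walks

module WalkSum (R : RealField) {n : ℕ} (H : Graph n) where
  open RealField R
  open Semantics R
  open OrderedField R
  open LazyWalk H

  private
    V : Set
    V = Fin (size H)

  nbhdSum : (V → ℝ) → V → ℝ
  nbhdSum f y = f y + sumFin (λ w → if adj H y w then f w else 0r)

  nbhdSum-cong : ∀ {f g : V → ℝ} → (∀ w → f w ≡ g w) → ∀ y → nbhdSum f y ≡ nbhdSum g y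
  nbhdSum-cong e y =
    cong₂ _+_ (e y) (sumFin-cong λ w → cong (λ x → if adj H y w then x else 0r) (e w))

  nbhdSum-+ : ∀ (f g : V → ℝ) y → nbhdSum (λ w → f w + g w) y ≡ nbhdSum f y + nbhdSum g y
  nbhdSum-+ f g y =
    trans (cong (f y + g y +_) (trans (sumFin-cong push)
      (sumFin-+ (λ w → if adj H y w then f w else 0r) (λ w → if adj H y w then g w else 0r)))) (+-interchange _ _ _ _)
    where
    push : ∀ w → (if adj H y w then f w + g w else 0r) ≡
                 (if adj H y w then f w else 0r) + (if adj H y w then g w else 0r)
    push w with adj H y w
    ... | true  = refl
    ... | false = sym (+-identity 0r)

  nbhdSum-* : ∀ a (f : V → ℝ) y → nbhdSum (λ w → a * f w) y ≡ a * nbhdSum f y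
  nbhdSum-* a f y =
    trans (cong (a * f y +_) (trans (sumFin-cong push)
      (sumFin-* a (λ w → if adj H y w then f w else 0r)))) (sym (distrib a _ _))
    where
    push : ∀ w → (if adj H y w then a * f w else 0r) ≡ a * (if adj H y w then f w else 0r)
    push w with adj H y w
    ... | true  = refl
    ... | false = sym (zeroʳ a)

  private
    masked-nonneg : ∀ {f : V → ℝ} → (∀ w → Nonneg (f w)) → ∀ y w →
                    Nonneg (if adj H y w then f w else 0r)
    masked-nonneg f≥0 y w with adj H y w
    ... | true  = f≥0 w
    ... | false = inj₂ refl

  nbhdSum-nonneg : ∀ {f : V → ℝ} → (∀ w → Nonneg (f w)) → ∀ y → Nonneg (nbhdSum f y)
  nbhdSum-nonneg f≥0 y = +-nonneg (f≥0 y) (sumFin-nonneg (masked-nonneg f≥0 y))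

  nbhdSum-pos : ∀ {f : V → ℝ} → (∀ w → Nonneg (f w)) → ∀ {y w} → y ∼ w → 0r < f w → 0r < nbhdSum f y
  nbhdSum-pos f≥0 {y} (inj₁ refl) h = pos-+-nonneg h (sumFin-nonneg (masked-nonneg f≥0 y))
  nbhdSum-pos {f} f≥0 {y} {w} (inj₂ a) h =
    nonneg-+-pos (f≥0 y) (sumFin-pos (masked-nonneg f≥0 y) w
      (subst (λ x → 0r < (if x then f w else 0r)) (sym a) h))

  nbhdSum-pos⁻ : ∀ {f : V → ℝ} → (∀ w → Nonneg (f w)) → ∀ {y} → 0r < nbhdSum f y → ∃ λ w → y ∼ w × 0r < f w
  nbhdSum-pos⁻ {f} f≥0 {y} h with +-pos⁻ (f≥0 y) h
  ... | inj₁ h₀ = y , inj₁ refl , h₀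
  ... | inj₂ hs with w , hw ← sumFin-pos⁻ (masked-nonneg f≥0 y) hs with adj H y w in a
  ...   | true  = w , inj₂ a , hw
  ...   | false = ⊥-elim (<-irrefl 0r hw)

  -- Walks are infinite sequences here, so a walk of `T` steps is represented by the sequence that
  -- stays forever at its last node.
  walkSum : ℕ → ((ℕ → V) → ℝ) → V → ℝ
  walkSum zero    F y = F (λ _ → y)
  walkSum (suc T) F y = nbhdSum (walkSum T (λ z → F (cons y z))) y

  walkSum-cong : ∀ T {F F′ : (ℕ → V) → ℝ} → (∀ z → F z ≡ F′ z) → ∀ y → walkSum T F y ≡ walkSum T F′ y
  walkSum-cong zero    e y = e _
  walkSum-cong (suc T) e y = nbhdSum-cong (walkSum-cong T (λ z → e (cons y z))) y

  walkSum-+ : ∀ T (F F′ : (ℕ → V) → ℝ) y →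
              walkSum T (λ z → F z + F′ z) y ≡ walkSum T F y + walkSum T F′ y
  walkSum-+ zero    F F′ y = refl
  walkSum-+ (suc T) F F′ y =
    trans (nbhdSum-cong (walkSum-+ T (F ∘ cons y) (F′ ∘ cons y)) y) (nbhdSum-+ _ _ y)

  walkSum-* : ∀ T a (F : (ℕ → V) → ℝ) y → walkSum T (λ z → a * F z) y ≡ a * walkSum T F y
  walkSum-* zero    a F y = refl
  walkSum-* (suc T) a F y = trans (nbhdSum-cong (walkSum-* T a (F ∘ cons y)) y) (nbhdSum-* a _ y)

  walkSum-0 : ∀ T y → walkSum T (λ _ → 0r) y ≡ 0r
  walkSum-0 T y = trans (walkSum-cong T (λ _ → sym (zeroˡ 0r)) y) (trans (walkSum-* T 0r _ y) (zeroˡ _))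

  walkSum-sumOver : {A : Set} → ∀ T (as : List A) (F : A → (ℕ → V) → ℝ) y →
                    walkSum T (λ z → sumOver as (λ a → F a z)) y ≡ sumOver as (λ a → walkSum T (F a) y)
  walkSum-sumOver T []       F y = walkSum-0 T y
  walkSum-sumOver T (a ∷ as) F y =
    trans (walkSum-+ T _ _ y) (cong (walkSum T (F a) y +_) (walkSum-sumOver T as F y))

  walkSum-nonneg : ∀ T {F} → (∀ z → Nonneg (F z)) → ∀ y → Nonneg (walkSum T F y)
  walkSum-nonneg zero    F≥0 y = F≥0 _
  walkSum-nonneg (suc T) F≥0 y = nbhdSum-nonneg (walkSum-nonneg T (F≥0 ∘ cons y)) y

  -- The representative of `z` among the sequences at which `walkSum T` evaluates its summand.
  truncate : ℕ → (ℕ → V) → ℕ → V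
  truncate zero    z = λ _ → z 0
  truncate (suc T) z = cons (z 0) (truncate T (z ∘ suc))

  truncate-≤ : ∀ T z i → i ≤ T → truncate T z i ≡ z i
  truncate-≤ zero    z zero    _       = refl
  truncate-≤ (suc T) z zero    _       = refl
  truncate-≤ (suc T) z (suc i) (s≤s h) = truncate-≤ T (z ∘ suc) i h

  walkSum-pos : ∀ T {F} → (∀ z → Nonneg (F z)) → ∀ z → IsWalk z →
                0r < F (truncate T z) → 0r < walkSum T F (z 0)
  walkSum-pos zero    F≥0 z wz h = h
  walkSum-pos (suc T) F≥0 z wz h =
    nbhdSum-pos (walkSum-nonneg T (F≥0 ∘ cons (z 0))) (wz 0)
      (walkSum-pos T (F≥0 ∘ cons (z 0)) (z ∘ suc) (wz ∘ suc) h)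

  walkSum-pos⁻ : ∀ T {F} → (∀ z → Nonneg (F z)) → ∀ y → 0r < walkSum T F y →
                 ∃ λ z → z 0 ≡ y × IsWalk z × 0r < F z
  walkSum-pos⁻ zero    F≥0 y h = (λ _ → y) , refl , (λ _ → inj₁ refl) , h
  walkSum-pos⁻ (suc T) F≥0 y h
    with w , y∼w , hw ← nbhdSum-pos⁻ (walkSum-nonneg T (F≥0 ∘ cons y)) h
    with z , refl , wz , hz ← walkSum-pos⁻ T (F≥0 ∘ cons y) w hw
    = cons y z , refl , (λ { zero → y∼w ; (suc i) → wz i }) , hz

-- The layers compute walk sums

module Simulation (R : RealField) {n : ℕ} (H : Graph n) {b : ℕ}
                  (e : Fin (size H) → Vec (RealField.ℝ R) b) where
  open RealField R
  open Semantics R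
  open OrderedField R
  open TermEval R
  open WalkSum R H

  private
    V : Set
    V = Fin (size H)

  weight : Term b → V → ℝ
  weight t y = eval t (lookup (e y))

  columnValue : ℕ → Column b → (ℕ → V) → ℝ
  columnValue zero    c z = weight (c 0) (z 0)
  columnValue (suc T) c z = weight (c 0) (z 0) * columnValue T (c ∘ suc) (z ∘ suc)

  columnSum : ℕ → Column b → V → ℝ
  columnSum T c = walkSum T (columnValue T c)

  -- All walks counted here start at `y`, so the weight of the first node factors out of the sum.
  -- This is the recursion that `stepCom` carries out.
  columnSum-suc : ∀ T c y → columnSum (suc T) c y ≡ weight (c 0) y * nbhdSum (columnSum T (c ∘ suc)) y
  columnSum-suc T c y =
    trans (nbhdSum-cong (walkSum-* T _ (columnValue T (c ∘ suc))) y) (nbhdSum-* _ _ y)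

  columnValue-one : ∀ T z → columnValue T one z ≡ 1r
  columnValue-one zero    z = fromℚ-1
  columnValue-one (suc T) z = trans (cong₂ _*_ fromℚ-1 (columnValue-one T (z ∘ suc))) (*-identity 1r)

  columnValue-at : ∀ T s t z → s ≤ T → columnValue T (at s t) z ≡ weight t (z s)
  columnValue-at zero    zero    t z _       = refl
  columnValue-at (suc T) zero    t z _       =
    trans (cong (weight t (z 0) *_) (columnValue-one T (z ∘ suc))) (*-identityʳ _)
  columnValue-at (suc T) (suc s) t z (s≤s h) =
    trans (cong₂ _*_ fromℚ-1 (columnValue-at T s t (z ∘ suc) h)) (*-identity _)

  columnValue-mul : ∀ T c d z →
    columnValue T (λ i → mul (c i) (d i)) z ≡ columnValue T c z * columnValue T d z
  columnValue-mul zero    c d z = eval-mul (c 0) (d 0) _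
  columnValue-mul (suc T) c d z =
    trans (cong₂ _*_ (eval-mul (c 0) (d 0) _) (columnValue-mul T (c ∘ suc) (d ∘ suc) (z ∘ suc)))
          (*-interchange _ _ _ _)

  value : ℕ → List (Column b) → (ℕ → V) → ℝ
  value T S z = sumOver S (λ c → columnValue T c z)

  value-⊗ : ∀ T S S′ z → value T (S ⊗ S′) z ≡ value T S z * value T S′ z
  value-⊗ T S S′ z = sumOver-cartesianProductWith (λ c d → columnValue-mul T c d z) S S′

  value-one : ∀ T z → value T (one ∷ []) z ≡ 1r
  value-one T z = trans (+-identityʳ _) (columnValue-one T z)

  value-⨂ : ∀ T {k} (S : Fin k → List (Column b)) z → value T (⨂ S) z ≡ prodFin (λ i → value T (S i) z)
  value-⨂ T {zero}  S z = value-one T z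
  value-⨂ T {suc k} S z = trans (value-⊗ T (S zero) _ z) (cong (value T (S zero) z *_) (value-⨂ T (S ∘ suc) z))

  value-⨁ : ∀ T {k} (S : Fin k → List (Column b)) z → value T (⨁ S) z ≡ sumFin (λ i → value T (S i) z)
  value-⨁ T {zero}  S z = refl
  value-⨁ T {suc k} S z = trans (sumOver-++ (S zero) _ _) (cong (value T (S zero) z +_) (value-⨁ T (S ∘ suc) z))

  -- The invariant maintained by the layers of `walkLayers`.
  state : ∀ {M} → ℕ → (Fin M → Column b) → V → Vec ℝ (b ℕ.+ M)
  state T cs y = e y Vec.++ tabulate (λ j → columnSum T (cs j) y)

  applyCom-cong : ∀ {d d′} (com : Vec (Term (d ℕ.+ d)) d′) {f g : V → Vec ℝ d} →
                  (∀ w → f w ≡ g w) → ∀ y → applyCom H com f y ≡ applyCom H com g y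
  applyCom-cong com {f} {g} eq y =
    cong (λ x → Vec.map (λ t → eval t (lookup x)) com) (cong₂ Vec._++_ (eq y) aggSum-cong)
    where
    aggSum-cong : aggSum H f y ≡ aggSum H g y
    aggSum-cong = Vec.tabulate-cong λ i →
      sumFin-cong λ w → cong (λ x → if adj H y w then lookup x i else 0r) (eq w)

  -- Embeddings are functions known to agree only pointwise, so their agreement has to be carried
  -- through the remaining layers.
  run-cong : ∀ {d} (ls : Layers d) {f g : V → Vec ℝ d} →
             (∀ w → f w ≡ g w) → ∀ y → run H ls f y ≡ run H ls g y
  run-cong (last com)     eq y = cong (λ x → lookup x zero) (applyCom-cong com eq y)
  run-cong (layer com ls) eq y = run-cong ls (applyCom-cong com eq) y

  private
    map-tabulate-++ : ∀ {A B : Set} {k m} (h : A → B) {f : Fin k → A} {g : Fin m → A} {xs} {g′ : Fin m → B} →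
      (∀ i → h (f i) ≡ lookup xs i) → (∀ j → h (g j) ≡ g′ j) →
      Vec.map h (tabulate f Vec.++ tabulate g) ≡ xs Vec.++ tabulate g′
    map-tabulate-++ h {f} {g} {xs} p q =
      trans (Vec.map-++ h (tabulate f) (tabulate g))
        (cong₂ Vec._++_
          (trans (sym (Vec.tabulate-∘ h f)) (trans (Vec.tabulate-cong p) (Vec.tabulate∘lookup xs)))
          (trans (sym (Vec.tabulate-∘ h g)) (Vec.tabulate-cong q)))

  initCom-correct : ∀ {M} (cs : Fin M → Column b) y → applyCom H (initCom cs) e y ≡ state 0 cs y
  initCom-correct cs y = map-tabulate-++ _ own (λ j → eval-rename (_↑ˡ b) own (cs j 0))
    where
    own : ∀ i → lookup (e y Vec.++ aggSum H e y) (i ↑ˡ b) ≡ lookup (e y) i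
    own = Vec.lookup-++ˡ (e y) _

  stepCom-correct : ∀ {M} T (cs : Fin M → Column b) y →
    applyCom H (stepCom cs) (state T (λ j → cs j ∘ suc)) y ≡ state (suc T) cs y
  stepCom-correct {M} T cs y = map-tabulate-++ _ own λ j →
    -- `closedNbhdTerm` is local to `stepCom`, so its body is spelled out.
    trans (eval-mul (rename base (cs j 0)) (add (var ((b ↑ʳ j) ↑ˡ (b ℕ.+ M))) (var ((b ℕ.+ M) ↑ʳ (b ↑ʳ j)))) ρ)
      (trans (cong₂ _*_ (eval-rename base {ρ} own (cs j 0)) (nbhd j)) (sym (columnSum-suc T (cs j) y)))
    where
    st : V → Vec ℝ (b ℕ.+ M)
    st = state T (λ j → cs j ∘ suc)

    ρ : Fin ((b ℕ.+ M) ℕ.+ (b ℕ.+ M)) → ℝ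
    ρ = lookup (st y Vec.++ aggSum H st y)

    base : Fin b → Fin ((b ℕ.+ M) ℕ.+ (b ℕ.+ M))
    base i = (i ↑ˡ M) ↑ˡ (b ℕ.+ M)

    own : ∀ i → ρ (base i) ≡ lookup (e y) i
    own i = trans (Vec.lookup-++ˡ (st y) _ (i ↑ˡ M)) (Vec.lookup-++ˡ (e y) _ i)

    sums : ∀ w j → lookup (st w) (b ↑ʳ j) ≡ columnSum T (cs j ∘ suc) w
    sums w j = trans (Vec.lookup-++ʳ (e w) _ j) (Vec.lookup∘tabulate _ j)

    nbhd : ∀ j → ρ ((b ↑ʳ j) ↑ˡ (b ℕ.+ M)) + ρ ((b ℕ.+ M) ↑ʳ (b ↑ʳ j)) ≡
                 nbhdSum (columnSum T (cs j ∘ suc)) y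
    nbhd j = cong₂ _+_
      (trans (Vec.lookup-++ˡ (st y) _ (b ↑ʳ j)) (sums y j))
      (trans (Vec.lookup-++ʳ (st y) _ (b ↑ʳ j))
        (trans (Vec.lookup∘tabulate _ (b ↑ʳ j))
          (sumFin-cong λ w → cong (λ x → if adj H y w then x else 0r) (sums w j))))

  walkLayers-correct : ∀ {M} T (cs : Fin M → Column b) rest y →
    run H (walkLayers T cs rest) e y ≡ run H rest (state T cs) y
  walkLayers-correct zero    cs rest y = run-cong rest (initCom-correct cs) y
  walkLayers-correct (suc T) cs rest y =
    trans (walkLayers-correct T _ (layer (stepCom cs) rest) y) (run-cong rest (stepCom-correct T cs) y)

  guardedLayers-correct : ∀ T (S S′ : List (Column b)) y →
    run H (guardedLayers S S′ T) e y ≡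
    ifPosR (walkSum T (value T S′) y) 0r (walkSum T (value T S) y)
  guardedLayers-correct T S S′ y =
    trans (walkLayers-correct T cs (last (ifPos (right S S′) (const ℚ.0ℚ) (left S S′) ∷ [])) y)
      (trans (cong₂ (λ x x′ → ifPosR x′ (fromℚ ℚ.0ℚ) x)
               (part S (_↑ˡ length S′) (Vec.lookup-++ˡ (Vec.fromList S) _))
               (part S′ (length S ↑ʳ_) (Vec.lookup-++ʳ (Vec.fromList S) _)))
             (cong (λ x → ifPosR (walkSum T (value T S′) y) x (walkSum T (value T S) y)) fromℚ-0))
    where
    cs : Fin (length S ℕ.+ length S′) → Column b
    cs = joined S S′

    D : ℕ
    D = b ℕ.+ (length S ℕ.+ length S′)

    ρ : Fin (D ℕ.+ D) → ℝ
    ρ = lookup (state T cs y Vec.++ aggSum H (state T cs) y)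

    ρ-column : ∀ j → ρ ((b ↑ʳ j) ↑ˡ D) ≡ columnSum T (cs j) y
    ρ-column j = trans (Vec.lookup-++ˡ (state T cs y) _ (b ↑ʳ j))
                   (trans (Vec.lookup-++ʳ (e y) _ j) (Vec.lookup∘tabulate _ j))

    -- Used twice, with `ι` the inclusion of either list into the joined one.
    part : (A : List (Column b)) (ι : Fin (length A) → Fin (length S ℕ.+ length S′)) →
           (∀ j → cs (ι j) ≡ lookup (Vec.fromList A) j) →
           eval (sumTerm (λ j → var ((b ↑ʳ ι j) ↑ˡ D))) ρ ≡ walkSum T (value T A) y
    part A ι eq =
      trans (eval-sumTerm (λ j → var ((b ↑ʳ ι j) ↑ˡ D)) ρ)
        (trans (sumFin-cong λ j → trans (ρ-column (ι j)) (cong (λ c → columnSum T c y) (eq j)))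
          -- Here the sum over columns and the sum over walks are interchanged.
          (trans (sumOver-lookup A (λ c → columnSum T c y)) (sym (walkSum-sumOver T A (columnValue T) y))))

-- Positivity of walk sums decides satisfiability

lookup-∷ʳ-inject₁ : ∀ {A : Set} {m} (xs : Vec A m) x i → lookup (xs ∷ʳ x) (inject₁ i) ≡ lookup xs i
lookup-∷ʳ-inject₁ (a ∷ xs) x zero    = refl
lookup-∷ʳ-inject₁ (a ∷ xs) x (suc i) = lookup-∷ʳ-inject₁ xs x i

lookup-∷ʳ-fromℕ : ∀ {A : Set} {m} (xs : Vec A m) x → lookup (xs ∷ʳ x) (Fin.fromℕ m) ≡ x
lookup-∷ʳ-fromℕ []       x = refl
lookup-∷ʳ-fromℕ (a ∷ xs) x = lookup-∷ʳ-fromℕ xs x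

module Correctness (R : RealField) {n : ℕ} (H : Graph n) (key : Fin (size H) → RealField.ℝ R)
                   (key-injective : Injective _≡_ _≡_ key) where
  open RealField R
  open Semantics R
  open OrderedField R
  open TermEval R
  open WalkSum R H
  open Simulation R H (initEmb H key)

  private
    V : Set
    V = Fin (size H)

    indicatorAt : Vec Bool n → V → ℝ
    indicatorAt l y = weight (indicator l (var ∘ inject₁)) y

    label-bits : ∀ y i → lookup (initEmb H key y) (inject₁ i) ≡ bit (lookup (lab H y) i)
    label-bits y i = trans (lookup-∷ʳ-inject₁ (Vec.map bit (lab H y)) (key y) i) (Vec.lookup-map i bit (lab H y))

    indicatorAt-≡ : ∀ l y → lab H y ≡ l → indicatorAt l y ≡ 1r
    indicatorAt-≡ l y = eval-indicator-≡ _ l (lab H y) (var ∘ inject₁) (label-bits y)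

    indicatorAt-≢ : ∀ l y → lab H y ≢ l → indicatorAt l y ≡ 0r
    indicatorAt-≢ l y = eval-indicator-≢ _ l (lab H y) (var ∘ inject₁) (label-bits y)

    keyDiff : V → V → ℝ
    keyDiff y w = key y + - key w

  -- The weight encoded by a formula, freed from its expansion into columns. It is nonnegative on
  -- every sequence, and positive exactly on those that satisfy the formula.
  truth : ∀ {T} → Form n T → (ℕ → V) → ℝ
  truth (neq s t _ _)    z = keyDiff (z s) (z t) * keyDiff (z s) (z t)
  truth (labelled s _ l) z = indicatorAt l (z s)
  truth (F ∧ F′)         z = truth F z * truth F′ z
  truth (yes _ ⇒ F)      z = truth F z
  truth (no _ ⇒ F)       z = 1r
  truth (⋀ F)            z = prodFin (λ i → truth (F i) z)
  truth (⋁ F)            z = sumFin (λ i → truth (F i) z)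

  value-columns : ∀ {T} (F : Form n T) z → value T (columns F) z ≡ truth F z
  value-columns {T} (neq s t s≤T t≤T) z =
    trans (value-⊗ T (difference s t) (difference s t) z) (cong₂ _*_ value-difference value-difference)
    where
    value-difference : value T (difference s t) z ≡ keyDiff (z s) (z t)
    value-difference = cong₂ _+_
      (trans (columnValue-at T s keyTerm z s≤T) (lookup-∷ʳ-fromℕ (Vec.map bit (lab H (z s))) (key (z s))))
      (trans (+-identityʳ _)
        (trans (columnValue-at T t _ z t≤T)
          (trans (fromℚ--1* _) (cong -_ (lookup-∷ʳ-fromℕ (Vec.map bit (lab H (z t))) (key (z t)))))))
  value-columns {T} (labelled s s≤T l) z = trans (+-identityʳ _) (columnValue-at T s _ z s≤T)
  value-columns {T} (F ∧ F′) z =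
    trans (value-⊗ T (columns F) (columns F′) z) (cong₂ _*_ (value-columns F z) (value-columns F′ z))
  value-columns (yes _ ⇒ F) z = value-columns F z
  value-columns {T} (no _ ⇒ F) z = value-one T z
  value-columns {T} (⋀ F) z = trans (value-⨂ T (columns ∘ F) z) (prodFin-cong λ i → value-columns (F i) z)
  value-columns {T} (⋁ F) z = trans (value-⨁ T (columns ∘ F) z) (sumFin-cong λ i → value-columns (F i) z)

  truth-nonneg : ∀ {T} (F : Form n T) z → Nonneg (truth F z)
  truth-nonneg (neq s t _ _) z = square-nonneg _
  truth-nonneg (labelled s _ l) z with Vec.≡-dec Bool._≟_ (lab H (z s)) l
  ... | yes p = inj₁ (subst (0r <_) (sym (indicatorAt-≡ l (z s) p)) 0<1)
  ... | no ¬p = inj₂ (sym (indicatorAt-≢ l (z s) ¬p))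
  truth-nonneg (F ∧ F′) z = *-nonneg (truth-nonneg F z) (truth-nonneg F′ z)
  truth-nonneg (yes _ ⇒ F) z = truth-nonneg F z
  truth-nonneg (no _ ⇒ F) z = inj₁ 0<1
  truth-nonneg (⋀ F) z = prodFin-nonneg (λ i → truth-nonneg (F i) z)
  truth-nonneg (⋁ F) z = sumFin-nonneg (λ i → truth-nonneg (F i) z)

  -- Injectivity of the keys enters in the case of `neq`: distinct nodes have distinct keys, and the
  -- square of a nonzero difference is positive.
  truth-pos : ∀ {T} (F : Form n T) z → _⊨_ H z F → 0r < truth F z
  truth-pos (neq s t _ _) z h = square-pos (h ∘ key-injective ∘ x∙y⁻¹≈ε⇒x≈y _ _)
  truth-pos (labelled s _ l) z h = subst (0r <_) (sym (indicatorAt-≡ l (z s) h)) 0<1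
  truth-pos (F ∧ F′) z (h , h′) = *-pos (truth-pos F z h) (truth-pos F′ z h′)
  truth-pos (yes p ⇒ F) z h = truth-pos F z (h p)
  truth-pos (no _ ⇒ F) z h = 0<1
  truth-pos (⋀ F) z h = prodFin-pos (λ i → truth-pos (F i) z (h i))
  truth-pos (⋁ F) z (i , h) = sumFin-pos (λ i → truth-nonneg (F i) z) i (truth-pos (F i) z h)

  -- Nonnegativity excludes cancellation: a positive product has only positive factors, and a
  -- positive sum has a positive term.
  truth-pos⁻ : ∀ {T} (F : Form n T) z → 0r < truth F z → _⊨_ H z F
  truth-pos⁻ (neq s t _ _) z h zs≡zt =
    <-irrefl 0r (subst (0r <_) (trans (cong (λ x → x * x) vanish) (zeroˡ 0r)) h)
    where
    vanish : keyDiff (z s) (z t) ≡ 0r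
    vanish = trans (cong (λ y → key y + - key (z t)) zs≡zt) (+-inverse _)
  truth-pos⁻ (labelled s _ l) z h with Vec.≡-dec Bool._≟_ (lab H (z s)) l
  ... | yes p = p
  ... | no ¬p = ⊥-elim (<-irrefl 0r (subst (0r <_) (indicatorAt-≢ l (z s) ¬p) h))
  truth-pos⁻ (F ∧ F′) z h
    with h₁ , h₂ ← *-pos⁻ (truth-nonneg F z) (truth-nonneg F′ z) h = truth-pos⁻ F z h₁ , truth-pos⁻ F′ z h₂
  truth-pos⁻ (yes _ ⇒ F) z h _ = truth-pos⁻ F z h
  truth-pos⁻ (no ¬p ⇒ F) z h p = ⊥-elim (¬p p)
  truth-pos⁻ (⋀ F) z h i = truth-pos⁻ (F i) z (prodFin-pos⁻ (λ i → truth-nonneg (F i) z) h i)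
  truth-pos⁻ (⋁ F) z h
    with i , hᵢ ← sumFin-pos⁻ (λ i → truth-nonneg (F i) z) h = i , truth-pos⁻ (F i) z hᵢ

  formSum : ∀ {T} → Form n T → V → ℝ
  formSum {T} F = walkSum T (value T (columns F))

  formSum-pos : ∀ {T} (F : Form n T) v → Sat H v F → 0r < formSum F v
  formSum-pos {T} F v (z , refl , wz , h) =
    subst (0r <_) (walkSum-cong T (λ z → sym (value-columns F z)) v)
      (walkSum-pos T (truth-nonneg F) z wz
        -- The sum sees only the truncation of `z`, which satisfies `F` as well because it agrees
        -- with `z` up to time `T`.
        (truth-pos F _ (⊨-resp H (λ i i≤T → sym (truncate-≤ T z i i≤T)) F h)))

  formSum-pos⁻ : ∀ {T} (F : Form n T) v → 0r < formSum F v → Sat H v F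
  formSum-pos⁻ {T} F v h
    with z , z₀ , wz , hz ← walkSum-pos⁻ T (truth-nonneg F) v (subst (0r <_) (walkSum-cong T (value-columns F) v) h)
    = z , z₀ , wz , truth-pos⁻ F z hz

  machine-accepts : ∀ {T} (F F′ : Form n T) v → Sat H v F → ¬ Sat H v F′ → Accepts H (machine F F′) key v
  machine-accepts {T} F F′ v sat ¬sat =
    subst (0r <_)
      (sym (trans (guardedLayers-correct T (columns F) (columns F′) v)
                  (ifPosR-¬pos (¬sat ∘ formSum-pos⁻ F′ v))))
      (formSum-pos F v sat)

  machine-accepts⁻ : ∀ {T} (F F′ : Form n T) v → Accepts H (machine F F′) key v → Sat H v F × ¬ Sat H v F′
  machine-accepts⁻ {T} F F′ v acc = formSum-pos⁻ F v (subst (0r <_) (ifPosR-¬pos ¬pos) out) , ¬pos ∘ formSum-pos F′ v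
    where
    out : 0r < ifPosR (formSum F′ v) 0r (formSum F v)
    out = subst (0r <_) (guardedLayers-correct T (columns F) (columns F′) v) acc

    -- If this sum were positive, the output would be 0 and not accepted.
    ¬pos : ¬ 0r < formSum F′ v
    ¬pos h = <-irrefl 0r (subst (0r <_) (ifPosR-pos h) out)

-- Injective self-maps of a finite set

iter : {A : Set} → (A → A) → ℕ → A → A
iter f zero    x = x
iter f (suc k) x = f (iter f k x)

iter-+ : {A : Set} (f : A → A) → ∀ i j x → iter f (i ℕ.+ j) x ≡ iter f i (iter f j x)
iter-+ f zero    j x = refl
iter-+ f (suc i) j x = cong f (iter-+ f i j x)

iter-fixed : {A : Set} (f : A → A) → ∀ {a x} → iter f a x ≡ x → ∀ b → iter f (b ℕ.* a) x ≡ x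
iter-fixed f         e zero    = refl
iter-fixed f {a} {x} e (suc b) =
  trans (iter-+ f a (b ℕ.* a) x) (trans (cong (iter f a) (iter-fixed f {a} e b)) e)

module _ {m : ℕ} {f : Fin m → Fin m} (f-injective : Injective _≡_ _≡_ f) where

  -- Among the first `m + 1` iterates of `x` two coincide by the pigeonhole principle. Injectivity
  -- cancels the applications that they have in common.
  injective⇒periodic : ∀ x → ∃ λ k → iter f (suc k) x ≡ x
  injective⇒periodic x
    with i , j , i<j , e ← Fin.pigeonhole (ℕ.n<1+n m) (λ i → iter f (toℕ i) x)
    with o , i+o≡j ← ℕ.m≤n⇒∃[o]m+o≡n i<j
    = o , sym (cancel (toℕ i) (trans e (cong (λ k → iter f k x) (trans (sym i+o≡j) (sym (ℕ.+-suc (toℕ i) o))))))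
    where
    cancel : ∀ i {y} → iter f i x ≡ iter f (i ℕ.+ y) x → x ≡ iter f y x
    cancel zero    e = e
    cancel (suc i) e = cancel i (f-injective e)

  injective⇒periodic₂ : ∀ x y → ∃ λ k → iter f (suc k) x ≡ x × iter f (suc k) y ≡ y
  injective⇒periodic₂ x y
    with a , ex ← injective⇒periodic x | b , ey ← injective⇒periodic y
    = b ℕ.+ a ℕ.* suc b ,
      subst (λ k → iter f k x ≡ x) (ℕ.*-comm (suc b) (suc a)) (iter-fixed f {suc a} ex (suc b)) ,
      iter-fixed f {suc b} ey (suc a)

  injective⇒surjective : ∀ x → ∃ λ y → f y ≡ x
  injective⇒surjective x with k , e ← injective⇒periodic x = iter f k x , e

  -- Some power f^(k+1) fixes both arguments, so f^k undoes f on them.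
  preserves⇒reflects : (P : Fin m → Fin m → Set) → (∀ {x y} → P x y → P (f x) (f y)) →
                       ∀ {x y} → P (f x) (f y) → P x y
  preserves⇒reflects P pres {x} {y} h
    with k , ex , ey ← injective⇒periodic₂ x y = subst₂ P ex ey (push k)
    where
    push : ∀ k → P (iter f (suc k) x) (iter f (suc k) y)
    push zero    = h
    push (suc k) = pres (push k)

-- Paths and tours

adj⇒≢ : ∀ {n} (G : Graph n) {a b} → adj G a b ≡ true → a ≢ b
adj⇒≢ G {a} e refl = case trans (sym e) (irrefl G a) of λ ()

module _ {n : ℕ} (G : Graph n) where
  open LazyWalk G

  infixr 5 _◂_ _⧺_

  data Path : Fin (size G) → Fin (size G) → Set where
    nil : ∀ {a} → Path a a
    _◂_ : ∀ {a b c} → adj G a b ≡ true → Path b c → Path a c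

  _⧺_ : ∀ {a b c} → Path a b → Path b c → Path a c
  nil     ⧺ q = q
  (e ◂ p) ⧺ q = e ◂ (p ⧺ q)

  reversePath : ∀ {a b} → Path a b → Path b a
  reversePath nil     = nil
  reversePath (e ◂ p) = reversePath p ⧺ (trans (Graph.sym G _ _) e ◂ nil)

  reach⇒path : ∀ {a b} → Reach G a b → Path a b
  reach⇒path here       = nil
  reach⇒path (step r e) = reach⇒path r ⧺ (e ◂ nil)

  pathLength : ∀ {a b} → Path a b → ℕ
  pathLength nil     = 0
  pathLength (_ ◂ p) = suc (pathLength p)

  -- Past its end a path stays at its last node, which turns it into an infinite lazy walk.
  node : ∀ {a b} → Path a b → ℕ → Fin (size G)
  node {a} nil     = λ _ → a
  node {a} (_ ◂ p) = cons a (node p)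

  node-0 : ∀ {a b} (p : Path a b) → node p 0 ≡ a
  node-0 nil     = refl
  node-0 (_ ◂ _) = refl

  node-walk : ∀ {a b} (p : Path a b) → IsWalk (node p)
  node-walk nil     i       = inj₁ refl
  node-walk (e ◂ p) zero    = inj₂ (subst (λ b → adj G _ b ≡ true) (sym (node-0 p)) e)
  node-walk (e ◂ p) (suc i) = node-walk p i

  -- The bound places the edge before the constant tail of `node`, so that `i` and `suc i` are both
  -- at most the length.
  Traverses : ∀ {a b} → Path a b → Fin (size G) → Fin (size G) → Set
  Traverses p c d = ∃ λ i → i ℕ.< pathLength p × node p i ≡ c × node p (suc i) ≡ d

  traverses-◂ : ∀ {a b c x y} (e : adj G a b ≡ true) (p : Path b c) →
                Traverses p x y → Traverses (e ◂ p) x y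
  traverses-◂ e p (i , i<l , ex , ey) = suc i , s≤s i<l , ex , ey

  traverses-⧺ˡ : ∀ {a b c x y} (p : Path a b) (q : Path b c) → Traverses p x y → Traverses (p ⧺ q) x y
  traverses-⧺ˡ (e ◂ p) q (zero , _ , ex , ey) =
    zero , s≤s z≤n , ex , trans (trans (node-0 (p ⧺ q)) (sym (node-0 p))) ey
  traverses-⧺ˡ (e ◂ p) q (suc i , s≤s i<l , ex , ey) =
    traverses-◂ e (p ⧺ q) (traverses-⧺ˡ p q (i , i<l , ex , ey))

  traverses-⧺ʳ : ∀ {a b c x y} (p : Path a b) (q : Path b c) → Traverses q x y → Traverses (p ⧺ q) x y
  traverses-⧺ʳ nil     q t = t
  traverses-⧺ʳ (e ◂ p) q t = traverses-◂ e (p ⧺ q) (traverses-⧺ʳ p q t)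

  concatLoops : ∀ {a k} → (Fin k → Path a a) → Path a a
  concatLoops {k = zero}  p = nil
  concatLoops {k = suc k} p = p zero ⧺ concatLoops (p ∘ suc)

  traverses-concatLoops : ∀ {a k x y} (p : Fin k → Path a a) i →
                          Traverses (p i) x y → Traverses (concatLoops p) x y
  traverses-concatLoops p zero    t = traverses-⧺ˡ (p zero) _ t
  traverses-concatLoops p (suc i) t = traverses-⧺ʳ (p zero) _ (traverses-concatLoops (p ∘ suc) i t)

  -- `pos` selects one visit to each node. Selecting time 0 for `u` makes every placement send `u`
  -- to the start of the walk.
  record Tour (u : Fin (size G)) : Set where
    field
      len       : ℕ
      tour      : ℕ → Fin (size G)
      tour-0    : tour 0 ≡ u
      tour-walk : IsWalk tour
      tour-edge : ∀ {a b} → adj G a b ≡ true → ∃ λ i → i ℕ.< len × tour i ≡ a × tour (suc i) ≡ b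
      pos       : Fin (size G) → ℕ
      pos≤len   : ∀ a → pos a ≤ len
      tour-pos  : ∀ a → tour (pos a) ≡ a
      pos-u     : pos u ≡ 0

  -- For each ordered pair of adjacent nodes, a loop runs from `u` to the first, across the edge,
  -- and back from the second. The tour concatenates all these loops.
  connected⇒tour : ∀ u → Connected G u → Tour u
  connected⇒tour u conn = record
    { len = pathLength path ; tour = node path ; tour-0 = node-0 path ; tour-walk = node-walk path
    ; tour-edge = edge ; pos = proj₁ ∘ visit ; pos≤len = proj₁ ∘ proj₂ ∘ visit
    ; tour-pos = proj₂ ∘ proj₂ ∘ visit ; pos-u = visit-u }
    where
    loop : ∀ a b → Dec (adj G a b ≡ true) → Path u u
    loop a b (yes e) = reach⇒path (conn a) ⧺ (e ◂ reversePath (reach⇒path (conn b)))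
    loop a b (no _)  = nil

    traverses-loop : ∀ a b d → adj G a b ≡ true → Traverses (loop a b d) a b
    traverses-loop a b (yes e) _ =
      traverses-⧺ʳ (reach⇒path (conn a)) _ (0 , s≤s z≤n , refl , node-0 (reversePath (reach⇒path (conn b))))
    traverses-loop a b (no ¬e) e = ⊥-elim (¬e e)

    loops : Fin (size G) → Fin (size G) → Path u u
    loops a b = loop a b (adj G a b Bool.≟ true)

    path : Path u u
    path = concatLoops (λ a → concatLoops (loops a))

    edge : ∀ {a b} → adj G a b ≡ true → Traverses path a b
    edge {a} {b} e = traverses-concatLoops (λ a → concatLoops (loops a)) a
      (traverses-concatLoops (loops a) b (traverses-loop a b (adj G a b Bool.≟ true) e))

    visit : ∀ a → ∃ λ i → i ≤ pathLength path × node path i ≡ a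
    visit a with a Fin.≟ u
    -- `u` receives time 0 explicitly, for `pos-u`. Any other node is the end of the last edge of a
    -- path from `u`, and the tour traverses that edge.
    ... | yes refl = 0 , z≤n , node-0 path
    ... | no a≢u with conn a
    ...   | here     = ⊥-elim (a≢u refl)
    ...   | step r e with i , i<l , _ , ea ← edge e = suc i , i<l , ea

    visit-u : proj₁ (visit u) ≡ 0
    visit-u with u Fin.≟ u
    ... | yes refl = refl
    ... | no u≢u   = ⊥-elim (u≢u refl)

-- Splicing and reversing walks

module _ {n : ℕ} (H : Graph n) where
  open LazyWalk H

  ∼-sym : ∀ {v w} → v ∼ w → w ∼ v
  ∼-sym (inj₁ refl) = inj₁ refl
  ∼-sym (inj₂ e)    = inj₂ (trans (Graph.sym H _ _) e)

  walk-reach : ∀ {z} → IsWalk z → ∀ i → Reach H (z 0) (z i)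
  walk-reach wz zero    = here
  walk-reach {z} wz (suc i) with wz i
  ... | inj₁ e = subst (Reach H (z 0)) e (walk-reach wz i)
  ... | inj₂ e = step (walk-reach wz i) e

  splice : ∀ L {y q} → IsWalk y → IsWalk q → q 0 ≡ y L →
           ∃ λ z → IsWalk z × (∀ i → i ≤ L → z i ≡ y i) × (∀ j → z (L ℕ.+ j) ≡ q j)
  splice zero    {y} {q} wy wq e = q , wq , (λ { zero _ → e }) , λ _ → refl
  splice (suc L) {y} {q} wy wq e
    with z , wz , init , tail ← splice L (wy ∘ suc) wq e
    = cons (y 0) z
    , (λ { zero → subst (y 0 ∼_) (sym (init 0 z≤n)) (wy 0) ; (suc i) → wz i })
    , (λ { zero _ → refl ; (suc i) (s≤s i≤L) → init i i≤L })
    , tail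

  -- For `t ≤ L` this runs `y` backwards from time `L` to time `t` and then waits: the maximum stops
  -- the clock at `t`. Lazy steps can be reversed because adjacency is symmetric.
  retreat : ∀ {y} → IsWalk y → ∀ t L → IsWalk (λ j → y (t ℕ.⊔ (L ℕ.∸ j)))
  retreat {y} wy t L j =
    subst (λ k → y (t ℕ.⊔ (L ℕ.∸ j)) ∼ y (t ℕ.⊔ k)) (ℕ.pred[m∸n]≡m∸[1+n] L j) (back (L ℕ.∸ j))
    where
    back : ∀ m → y (t ℕ.⊔ m) ∼ y (t ℕ.⊔ ℕ.pred m)
    back zero = inj₁ refl
    back (suc m) with t ℕ.≤? m
    ... | yes t≤m = subst₂ (λ i j → y i ∼ y j) (sym (ℕ.m≤n⇒m⊔n≡n (ℕ.m≤n⇒m≤1+n t≤m)))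
                      (sym (ℕ.m≤n⇒m⊔n≡n t≤m)) (∼-sym (wy m))
    ... | no t≰m  = inj₁ (cong y (trans (ℕ.m≥n⇒m⊔n≡m m<t) (sym (ℕ.m≥n⇒m⊔n≡m (ℕ.<⇒≤ m<t)))))
      where m<t = ℕ.≰⇒> t≰m

  -- Walk on for L steps, return to the node visited at time t, wait there until
  -- time 2L, and step to w.
  detour : ∀ {y} → IsWalk y → ∀ {t L w} → t ≤ L → y t ∼ w →
           ∃ λ z → IsWalk z × (∀ i → i ≤ L → z i ≡ y i) × z (L ℕ.+ L) ≡ y t × z (suc (L ℕ.+ L)) ≡ w
  detour {y} wy {t} {L} {w} t≤L yt∼w
    with q , wq , q-init , q-tail ←
           -- The way back takes `L - t` steps and waiting fills it up to `L`, so the step to `w`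
           -- happens at a time independent of `t`, as formulas with fixed times require.
           splice L {q = cons (y t) (λ _ → w)} (retreat wy t L) (λ { zero → yt∼w ; (suc _) → inj₁ refl })
             (cong y (sym (trans (cong (t ℕ.⊔_) (ℕ.n∸n≡0 L)) (ℕ.⊔-identityʳ t))))
    with z , wz , z-init , z-tail ← splice L wy wq (trans (q-init 0 z≤n) (cong y (ℕ.m≤n⇒m⊔n≡n t≤L)))
    = z , wz , z-init
    , trans (z-tail L) (trans (cong q (sym (ℕ.+-identityʳ L))) (q-tail 0))
    , trans (cong z (sym (ℕ.+-suc L L))) (trans (z-tail (suc L)) (trans (cong q (ℕ.+-comm 1 L)) (q-tail 1)))

-- The formulas `good` and `bad`

module IsoType {n : ℕ} (G : Graph n) (u : Fin (size G)) (τ : Tour G u) where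
  open Tour τ

  -- `len` steps for the placement, `len` to return to any placed node, and one to leave it.
  horizon : ℕ
  horizon = suc (len ℕ.+ len)

  early : ∀ {i} → i ≤ len → i ≤ horizon
  early i≤len = ℕ.m≤n⇒m≤1+n (ℕ.≤-trans i≤len (ℕ.m≤m+n len len))

  -- The times `pos b` alone make the placement injective. The other times tie the walk to the tour:
  -- once every visited node is a placed one, only the placed `tour i` is left for time `i`.
  distinct : Form n horizon
  distinct = ⋀ λ (i : Fin (suc len)) → ⋀ λ a → ¬? (tour (toℕ i) Fin.≟ a) ⇒
    neq (toℕ i) (pos a) (early (Fin.toℕ≤pred[n] i)) (early (pos≤len a))

  good : Form n horizon
  good = distinct ∧ ⋀ λ a → labelled (pos a) (early (pos≤len a)) (lab G a)

  -- Being at the placed `x` is an equality, so the first conjunct excludes all other placed nodes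
  -- instead. This amounts to the same when the node visited then is a placed one.
  extraEdgeAt : Fin (size G) → Form n horizon
  extraEdgeAt x =
      (⋀ λ a → ¬? (x Fin.≟ a) ⇒ neq (len ℕ.+ len) (pos a) (ℕ.n≤1+n _) (early (pos≤len a)))
    ∧ neq horizon (pos x) ℕ.≤-refl (early (pos≤len x))
    ∧ (⋀ λ a → (adj G x a Bool.≟ true) ⇒ neq horizon (pos a) ℕ.≤-refl (early (pos≤len a)))

  bad : Form n horizon
  bad = distinct ∧ ⋁ extraEdgeAt

  module _ (H : Graph n) where
    open LazyWalk H

    module Placement {z : ℕ → Fin (size H)} (wz : IsWalk z) (D : _⊨_ H z distinct) where

      ψ : Fin (size G) → Fin (size H)
      ψ a = z (pos a)

      separate : ∀ {i a} → i ≤ len → tour i ≢ a → z i ≢ ψ a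
      separate {i} {a} i≤len =
        subst (λ j → tour j ≢ a → z j ≢ ψ a) (Fin.toℕ-fromℕ< (s≤s i≤len)) (D (fromℕ< (s≤s i≤len)) a)

      ψ-injective : Injective _≡_ _≡_ ψ
      ψ-injective {a} {b} e with a Fin.≟ b
      ... | yes a≡b = a≡b
      ... | no a≢b  = ⊥-elim (separate (pos≤len a) (λ h → a≢b (trans (sym (tour-pos a)) h)) e)

      module _ (covered : ∀ i → ∃ λ c → z i ≡ ψ c) where

        -- By elimination: `z i` is some `ψ c`, and `distinct` rules out every `c` other than
        -- `tour i`.
        follows-tour : ∀ {i a} → i ≤ len → tour i ≡ a → z i ≡ ψ a
        follows-tour {i} i≤len refl with c , e ← covered i with tour i Fin.≟ c
        ... | yes h = trans e (cong ψ (sym h))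
        ... | no h  = ⊥-elim (separate i≤len h e)

        -- When the tour crosses the edge, the walk makes a lazy step from `ψ a` to `ψ b`. It cannot
        -- stay put, since `ψ` is injective and `a` differs from `b`.
        ψ-adj : ∀ {a b} → adj G a b ≡ true → adj H (ψ a) (ψ b) ≡ true
        ψ-adj {a} {b} e with i , i<len , ea , eb ← tour-edge e with wz i
        ... | inj₁ h = ⊥-elim (adj⇒≢ G e (ψ-injective (trans (sym za) (trans h zb))))
          where za = follows-tour (ℕ.<⇒≤ i<len) ea
                zb = follows-tour i<len eb
        ... | inj₂ h = subst₂ (λ v w → adj H v w ≡ true) (follows-tour (ℕ.<⇒≤ i<len) ea) (follows-tour i<len eb) h

    module Sound {v : Fin (size H)} (sat : Sat H v good) (¬sat : ¬ Sat H v bad) where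
      z    = proj₁ sat
      z₀   = proj₁ (proj₂ sat)
      wz   = proj₁ (proj₂ (proj₂ sat))
      D    = proj₁ (proj₂ (proj₂ (proj₂ sat)))
      labs = proj₂ (proj₂ (proj₂ (proj₂ sat)))
      open Placement wz D

      -- Otherwise a detour back to `ψ x` and across the edge to `w` would satisfy `bad`. It changes
      -- nothing up to time `len`, so the placement remains the same.
      nbhd-ψ : ∀ x w → adj H (ψ x) w ≡ true → ∃ λ a → adj G x a ≡ true × w ≡ ψ a
      nbhd-ψ x w e with Fin.any? (λ a → (adj G x a Bool.≟ true) ×-dec (w Fin.≟ ψ a))
      ... | yes found = found
      ... | no ¬found
        with z′ , wz′ , init , mid , end ← detour H wz (pos≤len x) (inj₂ e)
        = ⊥-elim (¬sat (z′ , trans (init 0 z≤n) z₀ , wz′ , D′ , x , stays , leaves , escapes))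
        where
        init-pos : ∀ a → z′ (pos a) ≡ ψ a
        init-pos a = init (pos a) (pos≤len a)

        D′ : _⊨_ H z′ distinct
        D′ i a ne = subst₂ _≢_ (sym (init (toℕ i) (Fin.toℕ≤pred[n] i))) (sym (init-pos a)) (D i a ne)

        stays : ∀ a → x ≢ a → z′ (len ℕ.+ len) ≢ z′ (pos a)
        stays a x≢a = subst₂ _≢_ (sym mid) (sym (init-pos a)) (x≢a ∘ ψ-injective)

        leaves : z′ horizon ≢ z′ (pos x)
        leaves = subst₂ _≢_ (sym end) (sym (init-pos x)) (adj⇒≢ H e ∘ sym)

        escapes : ∀ a → adj G x a ≡ true → z′ horizon ≢ z′ (pos a)
        escapes a h = subst₂ _≢_ (sym end) (sym (init-pos a)) (λ h′ → ¬found (a , h , h′))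

      ψ-u : ψ u ≡ v
      ψ-u = trans (cong z pos-u) z₀

      reached : ∀ {w} → Reach H v w → ∃ λ a → ψ a ≡ w
      reached here = u , ψ-u
      reached (step r e) with a , refl ← reached r with b , _ , h ← nbhd-ψ a _ e = b , sym h

      reach : ∀ i → Reach H v (z i)
      reach i = subst (λ v → Reach H v (z i)) z₀ (walk-reach H wz i)

      covered : ∀ i → ∃ λ c → z i ≡ ψ c
      covered i with c , e ← reached (reach i) = c , sym e

      ψ-adj⁻ : ∀ {a b} → adj H (ψ a) (ψ b) ≡ true → adj G a b ≡ true
      ψ-adj⁻ {a} {b} e with c , h , e′ ← nbhd-ψ a (ψ b) e =
        subst (λ c → adj G a c ≡ true) (sym (ψ-injective e′)) h

      iso : IsoToComponent G u H v
      iso = record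
        { φ = ψ ; φ-inj = ψ-injective ; φ-into = reach ∘ pos ; φ-onto = λ _ → reached
        ; φ-lab = labs ; φ-adj = λ a b → Bool-ext (ψ-adj⁻ {a} {b}) (ψ-adj covered) ; φ-point = ψ-u }
        where
        Bool-ext : ∀ {p q : Bool} → (p ≡ true → q ≡ true) → (q ≡ true → p ≡ true) → p ≡ q
        Bool-ext {true}          f g = sym (f refl)
        Bool-ext {false} {true}  f g = g refl
        Bool-ext {false} {false} f g = refl

    module Complete {v : Fin (size H)} (I : IsoToComponent G u H v) where
      open IsoToComponent I

      sat-good : Sat H v good
      sat-good = φ ∘ tour , trans (cong φ tour-0) φ-point , walk
               , (λ i a ne e → ne (trans (φ-inj e) (tour-pos a)))
               , (λ a → trans (φ-lab _) (cong (lab G) (tour-pos a)))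
        where
        walk : IsWalk (φ ∘ tour)
        walk i with tour-walk i
        ... | inj₁ e = inj₁ (cong φ e)
        ... | inj₂ e = inj₂ (trans (φ-adj _ _) e)

      -- `α` is the placement read back through `φ`, an injective self-map of the nodes of `G`. By
      -- finiteness it is onto, so every node of the walk is placed, and it reflects edges, so steps
      -- between placed nodes come from edges of `G`.
      ¬sat-bad : ¬ Sat H v bad
      ¬sat-bad (z , refl , wz , D , x , stays , leaves , escapes) =
        contra (covered (len ℕ.+ len)) (covered horizon)
        where
        open Placement wz D

        preimage : ∀ i → ∃ λ c → φ c ≡ z i
        preimage i = φ-onto (z i) (walk-reach H wz i)

        α : Fin (size G) → Fin (size G)
        α a = proj₁ (preimage (pos a))

        φα : ∀ a → φ (α a) ≡ ψ a
        φα a = proj₂ (preimage (pos a))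

        α-injective : Injective _≡_ _≡_ α
        α-injective {a} {b} e = ψ-injective (trans (sym (φα a)) (trans (cong φ e) (φα b)))

        covered : ∀ i → ∃ λ c → z i ≡ ψ c
        covered i with c , e ← preimage i with a , refl ← injective⇒surjective α-injective c =
          a , trans (sym e) (φα a)

        adj-φα : ∀ a b → adj H (ψ a) (ψ b) ≡ adj G (α a) (α b)
        adj-φα a b = trans (sym (cong₂ (adj H) (φα a) (φα b))) (φ-adj (α a) (α b))

        ψ-adj⁻ : ∀ {a b} → adj H (ψ a) (ψ b) ≡ true → adj G a b ≡ true
        ψ-adj⁻ {a} {b} e =
          -- `ψ` preserves edges by following the tour, hence so does `α`; finiteness makes `α`
          -- reflect them, and `adj-φα` transfers this to `ψ`.
          preserves⇒reflects α-injective (λ a b → adj G a b ≡ true)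
            (λ {a} {b} h → trans (sym (adj-φα a b)) (ψ-adj covered h))
            (trans (sym (adj-φα a b)) e)

        -- `stays` forces `c` to be `x`. The last step then either waits, against `leaves`, or
        -- follows the image of an edge of `G` at `x`, against `escapes`.
        contra : (∃ λ c → z (len ℕ.+ len) ≡ ψ c) → ¬ (∃ λ d → z horizon ≡ ψ d)
        contra (c , ec) (d , ed) with x Fin.≟ c
        ... | no x≢c = stays c x≢c ec
        ... | yes refl with wz (len ℕ.+ len)
        ...   | inj₁ e = leaves (trans (sym e) ec)
        ...   | inj₂ e = escapes d (ψ-adj⁻ (subst₂ (λ v w → adj H v w ≡ true) ec ed e)) ed

-- The network expresses the isomorphism type

module _ (R : RealField) {n : ℕ} (G : Graph n) (u : Fin (size G)) (τ : Tour G u) where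
  open RealField R using (ℝ)
  open Semantics R
  open IsoType G u τ

  iso⇒accepted : ∀ H v → InIsoType G u H v → ∀ (key : Fin (size H) → ℝ) → Injective _≡_ _≡_ key →
                 Accepts H (machine good bad) key v
  iso⇒accepted H v I key inj =
    Correctness.machine-accepts R H key inj good bad v (Complete.sat-good H I) (Complete.¬sat-bad H I)

  accepted⇒iso : ∀ H v (key : Fin (size H) → ℝ) → Injective _≡_ _≡_ key →
                 Accepts H (machine good bad) key v → InIsoType G u H v
  accepted⇒iso H v key inj acc = Sound.iso H (proj₁ sats) (proj₂ sats)
    where sats = Correctness.machine-accepts⁻ R H key inj good bad v acc

  machine-expresses : Expresses (machine good bad) (InIsoType G u)
  machine-expresses =
    (λ H v key₁ key₂ inj₁ inj₂ acc → iso⇒accepted H v (accepted⇒iso H v key₁ inj₁ acc) key₂ inj₂) ,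
    (λ H v → mk⇔ (iso⇒accepted H v)
                 -- Acceptance is assumed for all injective keys, so one such key must be exhibited:
                 -- the numbering of the nodes.
                 (λ acc → accepted⇒iso H v (fromℕ ∘ toℕ) numbering-injective (acc _ numbering-injective)))
    where
    numbering-injective : ∀ {m} → Injective _≡_ _≡_ (λ (i : Fin m) → fromℕ (toℕ i))
    numbering-injective = Fin.toℕ-injective ∘ OrderedField.fromℕ-injective R

theorem5p14 : (R : RealField) (n : ℕ) (G : Graph n) (u : Fin (size G)) →
    Connected G u →
    Σ (GNN n) (λ N → Semantics.Expresses R N (InIsoType G u))
theorem5p14 R n G u conn =
  machine (IsoType.good G u τ) (IsoType.bad G u τ) , machine-expresses R G u τ
  where τ = connected⇒tour G u conn
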